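{- Let $\mathcal{C}$ be a class of graphs of bounded expansion which is uniformly quasi-wide with a computable margin $s_{\mathcal{C}}$ and a computable bound function $N_{\mathcal{C}}$. Then the distance-$d$ dominating set problem on $\mathcal{C}$ (given $G\in\mathcal{C}$ and integers $k,d\ge 0$, decide whether $G$ has a set $X$ of at most $k$ vertices such that every vertex of $G$ has distance at most $d$ to a vertex of $X$) is fixed-parameter tractable with parameter $k+d$, where $k$ is the size of the solution.
   Context: Graphs are finite, simple and undirected; distance is shortest-path length. $N_r^G(v)$ is the set of vertices of $G$ at distance at most $r$ from $v$. A graph $H$ is a minor of $G$ at depth $r$, written $H\preceq_r G$, if there are pairwise disjoint non-empty connected subgraphs $G_v$ of $G$ ($v\in V(H)$) such that for every edge $\{u,v\}$ of $H$ there is an edge of $G$ between a vertex of $G_u$ and a vertex of $G_v$, and for each $v$ there is $w\in V(G_v)$ with $V(G_v)\subseteq N_r^{G_v}(w)$. A class $\mathcal{C}$ has bounded expansion if for every $r\ge 0$ there is a constant $c(r)$ such that $|E(H)|\le c(r)\,|V(H)|$ for every graph $H$ with $H\preceq_r G$ for some $G\in\mathcal{C}$. A set $A\subseteq V(G)$ is $r$-scattered in $G$ if $N_r^G(u)\cap N_r^G(v)=\varnothing$ for all distinct $u,v\in A$; $G-S$ is the subgraph induced by $V(G)\setminus S$. $\mathcal{C}$ is uniformly quasi-wide with margin $s_{\mathcal{C}}:\mathbb{N}\to\mathbb{N}$ and bound function $N_{\mathcal{C}}:\mathbb{N}\times\mathbb{N}\to\mathbb{N}$ if for all $r,m\ge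 0$, every $G\in\mathcal{C}$ and every $W\subseteq V(G)$ with $|W|>N_{\mathcal{C}}(r,m)$, there is $S\subseteq V(G)$ with $|S|<s_{\mathcal{C}}(r)$ such that $W$ contains a set of size at least $m$ that is $r$-scattered in $G-S$. (Classes of bounded expansion are nowhere dense, hence uniformly quasi-wide by a theorem of Nešetřil and Ossona de Mendez; the assumption is that the functions can be taken computable.) A parameterized problem is fixed-parameter tractable if there are a computable function $f$, a constant $c$, and an algorithm solving it in time $f(p)\cdot n^c$, where $p$ is the parameter and $n$ the order of the input graph; inputs are promised to satisfy $G\in\mathcal{C}$. -}

module Defs where

open import Data.Bool.Base using (Bool; false; T; if_then_else_; _∧_)
open import Data.Bool.Properties using (∧-comm; T-∧; T-≡; T?)
open import Data.Fin.Base using (Fin)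
open import Data.Fin.Properties using (_<?_)
open import Data.Fin.Subset using (Subset; _∈_; _∉_; _⊆_; ⊤; ∁; ∣_∣; Nonempty)
open import Data.Fin.Subset.Properties using (∈⊤)
open import Data.List.Base
  using (List; []; _∷_; length; map; filter; allFin; cartesianProduct)
open import Data.List.Relation.Unary.Unique.Propositional using (Unique)
open import Data.Nat.Base using (ℕ; zero; suc; _+_; _*_; _∸_; _^_; _⊔_; _≤_; _<_; _≥_; _>_)
open import Data.Nat.Properties using () renaming (_≟_ to _≟ℕ_)
open import Data.Product.Base using (∃-syntax; _×_; _,_; proj₁; proj₂)
open import Data.Vec.Base using (Vec; []; _∷_; lookup)
open import Data.Vec.Properties using (lookup⇒[]=)
open import Data.Vec.Relation.Binary.Pointwise.Inductive using (Pointwise)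
open import Function.Bundles using (_⇔_; Equivalence)
open import Relation.Binary.PropositionalEquality
  using (_≡_; _≢_; cong₂)
open import Relation.Nullary.Decidable.Core using (does; _×-dec_)
open import Relation.Nullary.Negation.Core using (¬_)

record Graph : Set where
  field
    order  : ℕ
    adj    : Fin order → Fin order → Bool
    symm   : ∀ u v → adj u v ≡ adj v u
    irrefl : ∀ v → adj v v ≡ false

  Vertex : Set
  Vertex = Fin order

  Adj : Vertex → Vertex → Set
  Adj u v = T (adj u v)

  -- Each undirected edge is counted once, at the pair (u , v) with u < v.
  edgeCount : ℕ
  edgeCount = length (filter (λ (u , v) → (u <? v) ×-dec T? (adj u v))
                             (cartesianProduct (allFin order) (allFin order)))

open Graph public using (order; Vertex)

-- A class of graphs need not be closed under isomorphism.
GraphClass : Set₁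
GraphClass = Graph → Set

record Subgraph (G : Graph) : Set where
  field
    verts     : Subset (order G)
    edge      : Vertex G → Vertex G → Bool
    edge-symm : ∀ u v → edge u v ≡ edge v u
    edge⊆adj  : ∀ {u v} → T (edge u v) → Graph.Adj G u v
    endpoint  : ∀ {u v} → T (edge u v) → u ∈ verts

open Subgraph public using (verts)

whole : (G : Graph) → Subgraph G
whole G = record
  { verts     = ⊤
  ; edge      = Graph.adj G
  ; edge-symm = Graph.symm G
  ; edge⊆adj  = λ e → e
  ; endpoint  = λ _ → ∈⊤
  }

induced : (G : Graph) → Subset (order G) → Subgraph G
induced G U = record
  { verts     = U
  ; edge      = λ u v → Graph.adj G u v ∧ (lookup U u ∧ lookup U v)
  ; edge-symm = λ u v → cong₂ _∧_ (Graph.symm G u v) (∧-comm (lookup U u) (lookup U v))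
  ; edge⊆adj  = λ e → proj₁ (Equivalence.to T-∧ e)
  ; endpoint  = λ {u} {v} e →
      lookup⇒[]= u U (Equivalence.to T-≡
        (proj₁ (Equivalence.to (T-∧ {lookup U u} {lookup U v})
          (proj₂ (Equivalence.to (T-∧ {Graph.adj G u v}) e)))))
  }

_-ᴳ_ : (G : Graph) → Subset (order G) → Subgraph G
G -ᴳ S = induced G (∁ S)

module _ {G : Graph} (K : Subgraph G) where
  open Subgraph K using (edge)

  data Walk : Vertex G → Vertex G → List (Vertex G) → Set where
    here : ∀ {v} → v ∈ verts K → Walk v v (v ∷ [])
    step : ∀ {u w v vs} → T (edge u w) → Walk w v vs → Walk u v (u ∷ vs)

  Path : Vertex G → Vertex G → ℕ → Set
  Path u v ℓ = ∃[ vs ] Walk u v vs × Unique vs × length vs ≡ suc ℓ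

  Distance : Vertex G → Vertex G → ℕ → Set
  Distance u v ℓ = Path u v ℓ × (∀ {ℓ′} → Path u v ℓ′ → ℓ ≤ ℓ′)

  DistanceAtMost : ℕ → Vertex G → Vertex G → Set
  DistanceAtMost r u v = ∃[ ℓ ] Distance u v ℓ × ℓ ≤ r

  Connected : Set
  Connected = ∀ {u v} → u ∈ verts K → v ∈ verts K → ∃[ ℓ ] Path u v ℓ

  Scattered : ℕ → Subset (order G) → Set
  Scattered r A =
    A ⊆ verts K ×
    (∀ {u v} → u ∈ A → v ∈ A → u ≢ v →
     ∀ x → ¬ (DistanceAtMost r u x × DistanceAtMost r v x))

record _⪯[_]_ (H : Graph) (r : ℕ) (G : Graph) : Set where
  field
    branch    : Vertex H → Subgraph G
    nonempty  : ∀ v → Nonempty (verts (branch v))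
    connected : ∀ v → Connected (branch v)
    disjoint  : ∀ {u v} → u ≢ v → ∀ {x} → x ∈ verts (branch u) → x ∉ verts (branch v)
    edges     : ∀ {u v} → Graph.Adj H u v →
                ∃[ x ] ∃[ y ] x ∈ verts (branch u) × y ∈ verts (branch v) × Graph.Adj G x y
    radius    : ∀ v → ∃[ w ] w ∈ verts (branch v) ×
                (∀ {x} → x ∈ verts (branch v) → DistanceAtMost (branch v) r w x)

BoundedExpansion : GraphClass → Set
BoundedExpansion C =
  ∀ r → ∃[ c ] (∀ {H G} → C G → H ⪯[ r ] G → Graph.edgeCount H ≤ c * order H)

UniformlyQuasiWide : GraphClass → (ℕ → ℕ) → (ℕ → ℕ → ℕ) → Set
UniformlyQuasiWide C s N =
  ∀ r m {G} → C G → (W : Subset (order G)) → ∣ W ∣ > N r m →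
  ∃[ S ] ∣ S ∣ < s r ×
  (∃[ A ] A ⊆ W × ∣ A ∣ ≥ m × Scattered (G -ᴳ S) r A)

-- Computability is taken in the sense of Kleene's μ-recursive functions, and
-- Rec n is the syntax of the n-ary ones.
data Rec : ℕ → Set where
  zeroᴿ : Rec 0
  sucᴿ  : Rec 1
  projᴿ : ∀ {n} → Fin n → Rec n
  compᴿ : ∀ {m n} → Rec m → Vec (Rec n) m → Rec n
  precᴿ : ∀ {n} → Rec n → Rec (suc (suc n)) → Rec (suc n)
  μᴿ    : ∀ {n} → Rec (suc n) → Rec n

infix 4 _·_⇓_

data _·_⇓_ : ∀ {n} → Rec n → Vec ℕ n → ℕ → Set where
  zero⇓  : zeroᴿ · [] ⇓ 0
  suc⇓   : ∀ {x} → sucᴿ · x ∷ [] ⇓ suc x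
  proj⇓  : ∀ {n} {i : Fin n} {xs} → projᴿ i · xs ⇓ lookup xs i
  comp⇓  : ∀ {m n} {g : Rec m} {hs : Vec (Rec n) m} {xs ys z} →
           Pointwise (λ h y → h · xs ⇓ y) hs ys → g · ys ⇓ z →
           compᴿ g hs · xs ⇓ z
  prec⇓₀ : ∀ {n} {g : Rec n} {h xs z} →
           g · xs ⇓ z → precᴿ g h · 0 ∷ xs ⇓ z
  prec⇓₊ : ∀ {n} {g : Rec n} {h x xs y z} →
           precᴿ g h · x ∷ xs ⇓ y → h · x ∷ y ∷ xs ⇓ z →
           precᴿ g h · suc x ∷ xs ⇓ z
  μ⇓     : ∀ {n} {g : Rec (suc n)} {xs y} →
           (∀ {x} → x < y → ∃[ z ] g · x ∷ xs ⇓ suc z) → g · y ∷ xs ⇓ 0 →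
           μᴿ g · xs ⇓ y

Computable₁ : (ℕ → ℕ) → Set
Computable₁ f = ∃[ e ] (∀ x → e · x ∷ [] ⇓ f x)

Computable₂ : (ℕ → ℕ → ℕ) → Set
Computable₂ f = ∃[ e ] (∀ x y → e · x ∷ y ∷ [] ⇓ f x y)

-- Programs for a unit-cost random access machine.  Addition and truncated
-- subtraction are the only arithmetic, so a run of length t forms numbers at most
-- t bits longer than those in its input and constants; running time is therefore
-- polynomially related to Turing machine time, which would fail with unit-cost
-- multiplication.
-- The arguments i, j, k are fixed register numbers; load and store provide
-- indirect addressing.
data Program : Set where
  skip  : Program
  const : (i c : ℕ) → Program
  add   : (i j k : ℕ) → Program
  sub   : (i j k : ℕ) → Program
  load  : (i j : ℕ) → Program
  store : (i j : ℕ) → Program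
  _⨟_   : Program → Program → Program
  ifnz  : (i : ℕ) → Program → Program → Program
  while : (i : ℕ) → Program → Program

infixr 5 _⨟_

Memory : Set
Memory = ℕ → ℕ

_[_≔_] : Memory → ℕ → ℕ → Memory
(M [ a ≔ x ]) b = if does (b ≟ℕ a) then x else M b

-- Run P M t M′: started on M, the program P halts with M′ after t steps.
-- Every elementary instruction and every test counts as one step.
data Run : Program → Memory → ℕ → Memory → Set where
  skip   : ∀ {M} → Run skip M 1 M
  const  : ∀ {M i c} → Run (const i c) M 1 (M [ i ≔ c ])
  add    : ∀ {M i j k} → Run (add i j k) M 1 (M [ i ≔ M j + M k ])
  sub    : ∀ {M i j k} → Run (sub i j k) M 1 (M [ i ≔ M j ∸ M k ])
  load   : ∀ {M i j} → Run (load i j) M 1 (M [ i ≔ M (M j) ])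
  store  : ∀ {M i j} → Run (store i j) M 1 (M [ M i ≔ M j ])
  _⨟_    : ∀ {P Q M M′ M″ s t} → Run P M s M′ → Run Q M′ t M″ → Run (P ⨟ Q) M (s + t) M″
  ifnz₊  : ∀ {P Q M M′ i t} → M i ≢ 0 → Run P M t M′ → Run (ifnz i P Q) M (suc t) M′
  ifnz₀  : ∀ {P Q M M′ i t} → M i ≡ 0 → Run Q M t M′ → Run (ifnz i P Q) M (suc t) M′
  while₊ : ∀ {P M M′ M″ i s t} → M i ≢ 0 → Run P M s M′ → Run (while i P) M′ t M″ →
           Run (while i P) M (suc (s + t)) M″
  while₀ : ∀ {P M i} → M i ≡ 0 → Run (while i P) M 1 M

-- The input occupies the cells 0, 1, 2, …; all other cells start at 0.
initial : List ℕ → Memory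
initial []       _       = 0
initial (x ∷ xs) zero    = x
initial (x ∷ xs) (suc a) = initial xs a

record ParameterizedProblem : Set₁ where
  field
    Instance  : Set
    encode    : Instance → List ℕ
    size      : Instance → ℕ
    parameter : Instance → ℕ
    Promise   : Instance → Set
    Yes       : Instance → Set

-- The answer is read off cell 0: 1 means yes, anything else means no.
-- The factor 1 ⊔ n differs from n only for the empty graph, where a bound
-- f(p) · 0ᶜ would allow no step at all.
FixedParameterTractable : ParameterizedProblem → Set
FixedParameterTractable Π =
  ∃[ P ] ∃[ f ] ∃[ c ] Computable₁ f ×
  (∀ x → Promise x →
   ∃[ t ] ∃[ M ] Run P (initial (encode x)) t M ×
   t ≤ f (parameter x) * (1 ⊔ size x) ^ c ×
   (M 0 ≡ 1 ⇔ Yes x))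
  where open ParameterizedProblem Π

HasDominatingSet : Graph → ℕ → ℕ → Set
HasDominatingSet G k d =
  ∃[ X ] ∣ X ∣ ≤ k × (∀ v → ∃[ x ] x ∈ X × DistanceAtMost (whole G) d v x)

adjacencyMatrix : Graph → List ℕ
adjacencyMatrix G =
  map (λ (u , v) → if Graph.adj G u v then 1 else 0)
      (cartesianProduct (allFin (order G)) (allFin (order G)))

DistanceDominatingSet : GraphClass → ParameterizedProblem
DistanceDominatingSet C = record
  { Instance  = Graph × ℕ × ℕ
  ; encode    = λ (G , k , d) → k ∷ d ∷ order G ∷ adjacencyMatrix G
  ; size      = λ (G , k , d) → order G
  ; parameter = λ (G , k , d) → k + d
  ; Promise   = λ (G , k , d) → C G
  ; Yes       = λ (G , k , d) → HasDominatingSet G k d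
  }

{-# OPTIONS --safe #-}
-- Greedy domination core.  Scan the vertices and keep a list W, adding v exactly when
-- some k centres are within distance d of all of W but not of v.  Then k centres that
-- dominate W dominate every scanned vertex.  The list has bounded length: if it were
-- long, quasi-wideness would give a small S and many vertices of W that are scattered in
-- G - S, among them k + 2 with the same distances to S.  The centres that were found
-- when the last of these was added serve two of the others from a common centre; one of
-- the two paths must meet S, and can be rerouted to the last one, a contradiction.
-- Whether k centres as above exist is tested by enumerating the maps from W to the
-- centres, so only |W| and k enter the exponential part of the running time.  The
-- program evaluates neither s nor N, which only bound its running time.
--
-- All data live in one table filled cell by cell with the value of a bounded arithmetic
-- expression.  If all loops met in the evaluation are shorter than Z, the running time
-- is bounded by a polynomial in Z that depends on the expression only.
module Submission where

open import Data.Bool.Base using (true; false; T; if_then_else_)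
open import Data.Bool.Properties using (T?; T-∧; T-≡)
open import Data.Empty using (⊥-elim)
open import Data.Fin.Base using (Fin; zero; suc; toℕ; fromℕ<)
open import Data.Fin.Properties
  using (any?; pigeonhole; toℕ<n; toℕ-fromℕ<; toℕ-injective)
  renaming (_≟_ to _≟ᶠ_; <⇒≢ to <ᶠ⇒≢)
open import Data.Fin.Subset
  using (Subset; _∈_; _⊆_; ⁅_⁆; _∪_; ∁; ∣_∣; ⊥; outside; inside)
open import Data.Fin.Subset.Properties
  using (_∈?_; ∈⊤; ∉⊥; x∉p⇒x∈∁p; x∈⁅x⁆; x∈⁅y⁆⇒x≡y; x∈p∪q⁺; x∈p∪q⁻; q⊆p∪q;
         p⊆q⇒∣p∣≤∣q∣; p⊂q⇒∣p∣<∣q∣; ∣⁅x⁆∣≡1; ∣⊥∣≡0)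
open import Data.List.Base as List
  using (List; []; _∷_; _++_; length; map; filter; tabulate; allFin; cartesianProduct)
open import Data.List.Membership.Propositional using () renaming (_∈_ to _∈ᴸ_)
open import Data.List.Membership.Propositional.Properties using (∈-filter⁺; ∈-lookup; ∈-map⁺)
open import Data.List.Properties
  using (length-map; length-++; length-tabulate; map-++; map-∘; map-tabulate)
open import Data.List.Relation.Binary.Sublist.Propositional
  using ([]; _∷_; _∷ʳ_; ⊆-refl; ⊆-trans) renaming (_⊆_ to _⊑_)
open import Data.List.Relation.Binary.Sublist.Propositional.Properties using (All-resp-⊆; filter-⊆)
open import Data.List.Relation.Unary.All as All using (All; []; _∷_)
open import Data.List.Relation.Unary.All.Properties using (¬Any⇒All¬; all-filter)
open import Data.List.Relation.Unary.AllPairs using ([]; _∷_)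
open import Data.List.Relation.Unary.Any using (here; there) renaming (any? to anyᴸ?)
open import Data.List.Relation.Unary.Unique.Propositional using (Unique)
open import Data.Nat.Base
  using (ℕ; zero; suc; _+_; _*_; _∸_; _^_; _⊔_; _⊓_; _≤_; _<_; z≤n; s≤s; NonZero; >-nonZero)
open import Data.Nat.Properties
open import Data.Nat.Tactic.RingSolver using (solve-∀)
open import Data.Product.Base using (∃-syntax; _×_; _,_; proj₁; proj₂)
open import Data.Sum.Base using (_⊎_; inj₁; inj₂; map₁)
open import Data.Unit.Base using (⊤)
open import Data.Vec.Base using (Vec; []; _∷_; lookup; here; there)
open import Data.Vec.Properties using ([]=⇒lookup)
open import Data.Vec.Relation.Binary.Pointwise.Inductive using ([]; _∷_)
open import Function.Base using (id; _∘_)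
open import Function.Bundles using (_⇔_; mk⇔; Equivalence)
open import Relation.Binary.PropositionalEquality
open import Relation.Nullary.Decidable using (Dec; yes; no; _×-dec_; dec-true; dec-false)
open import Relation.Nullary.Negation.Core using (¬_)
open import Defs
open Equivalence using (to; from)

-- Computable functions and polynomial bounds

-- The number k + 2 is made up of the last vertex `w` and k + 1 others, two of which must share one
-- of the k centres. Distances to S are capped at d + 1, so that there are at most (d + 2)^|S|
-- distance profiles. The cap loses nothing, because only paths of length at most d are rerouted.
-- The obstacle for the running time is that the program has no bound on |W| at hand: `s` and `N`
-- occur only in the analysis. The list W is therefore never stored. The table keeps the powers (k +
-- 2)^j, where j counts the vertices selected so far, and this one column serves three purposes: a
-- vertex is selected where the power grows, the powers are the place values of a code for a map
-- from W to the centres, and the last power is the range of the loop over all codes. These loops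
-- are short only because ladders are. Hence their safety is a statement about the actual contents
-- of the heap, and conjunctions are evaluated lazily, so that a stored number is used as a loop
-- range only where its meaning is known.

computable-id : Computable₁ (λ x → x)
computable-id = projᴿ zero , λ _ → proj⇓

computable-const : ∀ c → Computable₁ (λ _ → c)
computable-const zero    = compᴿ zeroᴿ [] , λ _ → comp⇓ [] zero⇓
computable-const (suc c) with computable-const c
... | e , p = compᴿ sucᴿ (e ∷ []) , λ x → comp⇓ (p x ∷ []) suc⇓

computable-∘ : ∀ {f g} → Computable₁ f → Computable₁ g → Computable₁ (λ x → f (g x))
computable-∘ {g = g} (e , p) (e′ , p′) =
  compᴿ e (e′ ∷ []) , λ x → comp⇓ (p′ x ∷ []) (p (g x))

computable-∘₂ : ∀ {h f g} → Computable₂ h → Computable₁ f → Computable₁ g →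
                Computable₁ (λ x → h (f x) (g x))
computable-∘₂ {f = f} {g} (e , p) (e′ , p′) (e″ , p″) =
  compᴿ e (e′ ∷ e″ ∷ []) , λ x → comp⇓ (p′ x ∷ p″ x ∷ []) (p (f x) (g x))

computable-suc : Computable₁ suc
computable-suc = sucᴿ , λ _ → suc⇓

computable-+ : Computable₂ _+_
computable-+ = precᴿ (projᴿ zero) (compᴿ sucᴿ (projᴿ (suc zero) ∷ [])) , run
  where
  run : ∀ x y → precᴿ (projᴿ zero) (compᴿ sucᴿ (projᴿ (suc zero) ∷ [])) · x ∷ y ∷ [] ⇓ x + y
  run zero    y = prec⇓₀ proj⇓
  run (suc x) y = prec⇓₊ (run x y) (comp⇓ (proj⇓ ∷ []) suc⇓)

computable-* : Computable₂ _*_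
computable-* with computable-+
... | e , p = precᴿ (compᴿ zeroᴿ []) next , run
  where
  next : Rec 3
  next = compᴿ e (projᴿ (suc (suc zero)) ∷ projᴿ (suc zero) ∷ [])
  run : ∀ x y → precᴿ (compᴿ zeroᴿ []) next · x ∷ y ∷ [] ⇓ x * y
  run zero    y = prec⇓₀ (comp⇓ [] zero⇓)
  run (suc x) y = prec⇓₊ (run x y) (comp⇓ (proj⇓ ∷ proj⇓ ∷ []) (p y (x * y)))

-- Primitive recursion runs on the first argument, which therefore has to be the exponent.
computable-flip-^ : Computable₂ (λ n m → m ^ n)
computable-flip-^ with computable-*
... | e , p = precᴿ base next , run
  where
  base : Rec 1
  base = compᴿ sucᴿ (compᴿ zeroᴿ [] ∷ [])
  next : Rec 3
  next = compᴿ e (projᴿ (suc (suc zero)) ∷ projᴿ (suc zero) ∷ [])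
  run : ∀ n m → precᴿ base next · n ∷ m ∷ [] ⇓ m ^ n
  run zero    m = prec⇓₀ (comp⇓ (comp⇓ [] zero⇓ ∷ []) suc⇓)
  run (suc n) m = prec⇓₊ (run n m) (comp⇓ (proj⇓ ∷ proj⇓ ∷ []) (p m (m ^ n)))

-- Since `2 ≤ Z`, constants and sums are absorbed into the exponent, and a single power of `Z` is
-- enough. Such a power later splits into a function of the parameter times a power of the order.
PolynomiallyBounded : (ℕ → ℕ) → Set
PolynomiallyBounded T = ∃[ h ] (∀ Z → 2 ≤ Z → T Z ≤ Z ^ h)

poly-id : PolynomiallyBounded (λ Z → Z)
poly-id = 1 , λ Z _ → ≤-reflexive (sym (*-identityʳ Z))

n≤2^n : ∀ n → n ≤ 2 ^ n
n≤2^n zero    = z≤n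
n≤2^n (suc n) = ≤-trans (+-mono-≤ (m^n>0 2 n) (n≤2^n n))
                  (≤-reflexive (cong (2 ^ n +_) (sym (+-identityʳ (2 ^ n)))))

poly-const : ∀ c → PolynomiallyBounded (λ _ → c)
poly-const c = c , λ Z 2≤Z → ≤-trans (n≤2^n c) (^-monoˡ-≤ c 2≤Z)

poly-* : ∀ {S T} → PolynomiallyBounded S → PolynomiallyBounded T →
         PolynomiallyBounded (λ Z → S Z * T Z)
poly-* (a , p) (b , q) = a + b , λ Z 2≤Z →
  ≤-trans (*-mono-≤ (p Z 2≤Z) (q Z 2≤Z)) (≤-reflexive (sym (^-distribˡ-+-* Z a b)))

poly-+ : ∀ {S T} → PolynomiallyBounded S → PolynomiallyBounded T →
         PolynomiallyBounded (λ Z → S Z + T Z)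
poly-+ {S} {T} (a , p) (b , q) = suc (a + b) , λ { (suc Z) 2≤Z →
  let open ≤-Reasoning
      a≤ = ^-monoʳ-≤ (suc Z) (m≤m+n a b)
      b≤ = ^-monoʳ-≤ (suc Z) (m≤n+m b a)
      X = suc Z ^ (a + b)
  in begin
    S (suc Z) + T (suc Z)     ≤⟨ +-mono-≤ (≤-trans (p _ 2≤Z) a≤) (≤-trans (q _ 2≤Z) b≤) ⟩
    X + X                     ≡⟨ cong (X +_) (sym (+-identityʳ X)) ⟩
    2 * X                     ≤⟨ *-monoˡ-≤ X 2≤Z ⟩
    suc Z * X                 ∎ }

-- Expressions and their compilation

≔-same : ∀ M i x → (M [ i ≔ x ]) i ≡ x
≔-same M i x rewrite dec-true (i ≟ i) refl = refl

≔-other : ∀ M {i} x {c} → c ≢ i → (M [ i ≔ x ]) c ≡ M c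
≔-other M {i} x {c} c≢i rewrite dec-false (c ≟ i) c≢i = refl

-- A Hoare triple for total correctness with a time bound, relative to one initial memory. Only an
-- upper bound on the time is kept, so branches of different cost can share a triple.
Exec : Program → Memory → ℕ → (Memory → Set) → Set
Exec P M T Q = ∃[ t ] ∃[ M′ ] Run P M t M′ × t ≤ T × Q M′

exec-≤ : ∀ {P M S T Q} → S ≤ T → Exec P M S Q → Exec P M T Q
exec-≤ S≤T (t , M′ , r , t≤S , q) = t , M′ , r , ≤-trans t≤S S≤T , q

exec-map : ∀ {P M T} {Q Q′ : Memory → Set} → (∀ {M} → Q M → Q′ M) → Exec P M T Q → Exec P M T Q′
exec-map f (t , M′ , r , t≤ , q) = t , M′ , r , t≤ , f q

infixr 5 _⟫_
_⟫_ : ∀ {P P′ M S T} {Q Q′ : Memory → Set} →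
      Exec P M S Q → (∀ {M′} → Q M′ → Exec P′ M′ T Q′) → Exec (P ⨟ P′) M (S + T) Q′
(s , M′ , r , s≤S , q) ⟫ k with k q
... | t , M″ , r′ , t≤T , q′ = s + t , M″ , r ⨟ r′ , +-mono-≤ s≤S t≤T , q′

Writes : ℕ → ℕ → Memory → Memory → Set
Writes i v M M′ = M′ i ≡ v × (∀ c → c ≢ i → M′ c ≡ M c)

writes : ∀ M i v → Writes i v M (M [ i ≔ v ])
writes M i v = ≔-same M i v , λ c → ≔-other M v

exec-const : ∀ {M i c} → Exec (const i c) M 1 (Writes i c M)
exec-const = 1 , _ , const , ≤-refl , writes _ _ _

exec-add : ∀ {M i j k v} → M j + M k ≡ v → Exec (add i j k) M 1 (Writes i v M)
exec-add refl = 1 , _ , add , ≤-refl , writes _ _ _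

exec-sub : ∀ {M i j k v} → M j ∸ M k ≡ v → Exec (sub i j k) M 1 (Writes i v M)
exec-sub refl = 1 , _ , sub , ≤-refl , writes _ _ _

exec-load : ∀ {M i j v} → M (M j) ≡ v → Exec (load i j) M 1 (Writes i v M)
exec-load refl = 1 , _ , load , ≤-refl , writes _ _ _

exec-store : ∀ {M i j a v} → M i ≡ a → M j ≡ v → Exec (store i j) M 1 (Writes a v M)
exec-store refl refl = 1 , _ , store , ≤-refl , writes _ _ _

-- The invariant is indexed by the number of rounds left, which register `r` holds. Each round pays
-- for one test besides the body, and the last test fails.
exec-while : ∀ {body r T} (I : ℕ → Memory → Set) →
             (∀ {i M} → I i M → M r ≡ i) →
             (∀ {i M} → I (suc i) M → Exec body M T (I i)) →
             ∀ i {M} → I i M → Exec (while r body) M (suc (i * suc T)) (I 0)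
exec-while I counter next zero q = 1 , _ , while₀ (counter q) , ≤-refl , q
exec-while {T = T} I counter next (suc i) q with next q
... | s , M′ , r , s≤T , q′ with exec-while I counter next i q′
...   | t , M″ , r′ , t≤ , q″ =
  suc (s + t) , M″ , while₊ (λ eq → 1+n≢0 (trans (sym (counter q)) eq)) r r′ ,
  s≤s (≤-trans (+-mono-≤ s≤T t≤) (≤-reflexive (+-suc T (i * suc T)))) , q″

-- The largest index is added first because the compiled loop counts down, with its counter doubling
-- as the bound variable.
sumTo : ℕ → (ℕ → ℕ) → ℕ
sumTo zero    f = 0
sumTo (suc n) f = f n + sumTo n f

-- The parameters are the four values in cells 0 to 3, get reads the heap, and
-- guard a b is b unless a is zero, in which case b is not evaluated.
data Expr (m : ℕ) : Set where
  var   : Fin m → Expr m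
  par   : Fin 4 → Expr m
  lit   : ℕ → Expr m
  _⊕_   : Expr m → Expr m → Expr m
  _⊖_   : Expr m → Expr m → Expr m
  _⊗_   : Expr m → Expr m → Expr m
  get   : Expr m → Expr m
  guard : Expr m → Expr m → Expr m
  sum   : Expr m → Expr (suc m) → Expr m

infixl 6 _⊕_ _⊖_
infixl 7 _⊗_

Heap : Set
Heap = ℕ → ℕ

guardℕ : ℕ → ℕ → ℕ
guardℕ zero    _ = 0
guardℕ (suc _) b = b

⟦_⟧ : ∀ {m} → Expr m → Heap → Vec ℕ 4 → Vec ℕ m → ℕ
⟦ var i ⟧     H γ ρ = lookup ρ i
⟦ par j ⟧     H γ ρ = lookup γ j
⟦ lit c ⟧     H γ ρ = c
⟦ a ⊕ b ⟧     H γ ρ = ⟦ a ⟧ H γ ρ + ⟦ b ⟧ H γ ρ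
⟦ a ⊖ b ⟧     H γ ρ = ⟦ a ⟧ H γ ρ ∸ ⟦ b ⟧ H γ ρ
⟦ a ⊗ b ⟧     H γ ρ = ⟦ a ⟧ H γ ρ * ⟦ b ⟧ H γ ρ
⟦ get a ⟧     H γ ρ = H (⟦ a ⟧ H γ ρ)
⟦ guard a b ⟧ H γ ρ = guardℕ (⟦ a ⟧ H γ ρ) (⟦ b ⟧ H γ ρ)
⟦ sum a b ⟧   H γ ρ = sumTo (⟦ a ⟧ H γ ρ) (λ i → ⟦ b ⟧ H γ (i ∷ ρ))

-- All loops met in the evaluation have at most Z rounds.
Safe : ∀ {m} → ℕ → Expr m → Heap → Vec ℕ 4 → Vec ℕ m → Set
Safe Z (var i)     H γ ρ = ⊤
Safe Z (par j)     H γ ρ = ⊤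
Safe Z (lit c)     H γ ρ = ⊤
Safe Z (a ⊕ b)     H γ ρ = Safe Z a H γ ρ × Safe Z b H γ ρ
Safe Z (a ⊖ b)     H γ ρ = Safe Z a H γ ρ × Safe Z b H γ ρ
Safe Z (a ⊗ b)     H γ ρ = Safe Z a H γ ρ × Safe Z b H γ ρ × ⟦ a ⟧ H γ ρ ≤ Z
Safe Z (get a)     H γ ρ = Safe Z a H γ ρ
Safe Z (guard a b) H γ ρ = Safe Z a H γ ρ × (0 < ⟦ a ⟧ H γ ρ → Safe Z b H γ ρ)
Safe Z (sum a b)   H γ ρ = Safe Z a H γ ρ × ⟦ a ⟧ H γ ρ ≤ Z ×
                           (∀ i → i < ⟦ a ⟧ H γ ρ → Safe Z b H γ (i ∷ ρ))

-- The bracketing copies the nesting of `⟫` in `compile-correct`, so that the two bounds agree by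
-- definition.
time : ∀ {m} → Expr m → ℕ → ℕ
time (var i)     Z = 2
time (par j)     Z = 2
time (lit c)     Z = 1
time (a ⊕ b)     Z = time a Z + (time b Z + 1)
time (a ⊖ b)     Z = time a Z + (time b Z + 1)
time (a ⊗ b)     Z = time a Z + (time b Z + (1 + (1 + ((1 + Z * 3) + 1))))
time (get a)     Z = time a Z + 3
time (guard a b) Z = time a Z + (2 + time b Z)
time (sum a b)   Z = time a Z + (1 + ((1 + Z * (1 + (1 + (1 + (time b Z + 1))))) + 1))

poly-time : ∀ {m} (e : Expr m) → PolynomiallyBounded (time e)
poly-time (var i)     = poly-const 2
poly-time (par j)     = poly-const 2
poly-time (lit c)     = poly-const 1
poly-time (a ⊕ b)     = poly-+ (poly-time a) (poly-+ (poly-time b) (poly-const 1))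
poly-time (a ⊖ b)     = poly-+ (poly-time a) (poly-+ (poly-time b) (poly-const 1))
poly-time (a ⊗ b)     = poly-+ (poly-time a) (poly-+ (poly-time b)
  (poly-+ (poly-const 3) (poly-+ (poly-* poly-id (poly-const 3)) (poly-const 1))))
poly-time (get a)     = poly-+ (poly-time a) (poly-const 3)
poly-time (guard a b) = poly-+ (poly-time a) (poly-+ (poly-const 2) (poly-time b))
poly-time (sum a b)   = poly-+ (poly-time a) (poly-+ (poly-const 2)
  (poly-+ (poly-* poly-id (poly-+ (poly-const 3) (poly-+ (poly-time b) (poly-const 1)))) (poly-const 1)))

-- The value is computed in cell x; loc gives the cells of the local variables.
-- Cells below x are preserved, and the heap starts at cell R.
compile : ∀ {m} → ℕ → Expr m → Vec ℕ m → ℕ → Program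
compile R (var i)     loc x = const x 0 ⨟ add x x (lookup loc i)
compile R (par j)     loc x = const x 0 ⨟ add x x (toℕ j)
compile R (lit c)     loc x = const x c
compile R (a ⊕ b)     loc x = compile R a loc x ⨟ compile R b loc (1 + x) ⨟ add x x (1 + x)
compile R (a ⊖ b)     loc x = compile R a loc x ⨟ compile R b loc (1 + x) ⨟ sub x x (1 + x)
compile R (a ⊗ b)     loc x =
  compile R a loc x ⨟ compile R b loc (1 + x) ⨟ const (2 + x) 0 ⨟ const (3 + x) 1 ⨟
  while x (add (2 + x) (2 + x) (1 + x) ⨟ sub x x (3 + x)) ⨟
  add x x (2 + x)
compile R (get a)     loc x = compile R a loc x ⨟ const (1 + x) R ⨟ add x (1 + x) x ⨟ load x x
compile R (guard a b) loc x = compile R a loc x ⨟ ifnz x (compile R b loc x) skip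
compile R (sum a b)   loc x =
  compile R a loc x ⨟ const (1 + x) 0 ⨟
  while x (const (2 + x) 1 ⨟ sub x x (2 + x) ⨟
           compile R b (x ∷ loc) (2 + x) ⨟ add (1 + x) (1 + x) (2 + x)) ⨟
  add x x (1 + x)

-- A bound above all scratch cells of the compiled code. It depends on the syntax only, so the start
-- of the heap can be a constant of the program placed beyond every scratch cell.
top : ∀ {m} → Expr m → ℕ → ℕ
top (var i)     x = 1 + x
top (par j)     x = 1 + x
top (lit c)     x = 1 + x
top (a ⊕ b)     x = top a x ⊔ top b (1 + x)
top (a ⊖ b)     x = top a x ⊔ top b (1 + x)
top (a ⊗ b)     x = top a x ⊔ top b (1 + x) ⊔ (4 + x)
top (get a)     x = top a x ⊔ (2 + x)
top (guard a b) x = top a x ⊔ top b x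
top (sum a b)   x = top a x ⊔ top b (2 + x)

<top : ∀ {m} (e : Expr m) x → x < top e x
<top (var i)     x = ≤-refl
<top (par j)     x = ≤-refl
<top (lit c)     x = ≤-refl
<top (a ⊕ b)     x = ≤-trans (<top a x) (m≤m⊔n _ _)
<top (a ⊖ b)     x = ≤-trans (<top a x) (m≤m⊔n _ _)
<top (a ⊗ b)     x = ≤-trans (<top a x) (≤-trans (m≤m⊔n _ _) (m≤m⊔n _ _))
<top (get a)     x = ≤-trans (<top a x) (m≤m⊔n _ _)
<top (guard a b) x = ≤-trans (<top a x) (m≤m⊔n _ _)
<top (sum a b)   x = ≤-trans (<top a x) (m≤m⊔n _ _)

module Compilation (R : ℕ) (H : Heap) (γ : Vec ℕ 4) where

  -- The cells from `x` up to `R` are scratch space. Pending operands and local variables lie below,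
  -- the heap above.
  Frame : ℕ → Memory → Memory → Set
  Frame x M M′ = ∀ c → c < x ⊎ R ≤ c → M′ c ≡ M c

  frame-trans : ∀ {x y M M′ M″} → x ≤ y → Frame x M M′ → Frame y M′ M″ → Frame x M M″
  frame-trans x≤y f g c h = trans (g c (map₁ (λ c<x → <-≤-trans c<x x≤y) h)) (f c h)

  frame-write : ∀ {x y v M M′ M″} → x ≤ y → y < R → Frame x M M′ → Writes y v M′ M″ → Frame x M M″
  frame-write {x} {y} x≤y y<R f (_ , o) c h = trans (o c (c≢y h)) (f c h)
    where
    c≢y : c < x ⊎ R ≤ c → c ≢ y
    c≢y (inj₁ c<x) refl = <⇒≱ c<x x≤y
    c≢y (inj₂ R≤c) refl = <⇒≱ y<R R≤c

  record Represents {m} (x : ℕ) (loc : Vec ℕ m) (ρ : Vec ℕ m) (M : Memory) : Set where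
    field
      4≤x    : 4 ≤ x
      loc<x  : ∀ i → lookup loc i < x
      locals : ∀ i → M (lookup loc i) ≡ lookup ρ i
      params : ∀ j → M (toℕ j) ≡ lookup γ j
      heap   : ∀ a → M (R + a) ≡ H a
  open Represents

  represents-mono : ∀ {m x y} {loc ρ : Vec ℕ m} {M} → x ≤ y → Represents x loc ρ M → Represents y loc ρ M
  represents-mono x≤y r .4≤x = ≤-trans (r .4≤x) x≤y
  represents-mono x≤y r .loc<x i = <-≤-trans (r .loc<x i) x≤y
  represents-mono x≤y r .locals = r .locals
  represents-mono x≤y r .params = r .params
  represents-mono x≤y r .heap = r .heap

  represents-frame : ∀ {m x} {loc ρ : Vec ℕ m} {M M′} → Frame x M M′ → Represents x loc ρ M → Represents x loc ρ M′
  represents-frame f r .4≤x = r .4≤x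
  represents-frame f r .loc<x = r .loc<x
  represents-frame f r .locals i = trans (f _ (inj₁ (r .loc<x i))) (r .locals i)
  represents-frame f r .params j = trans (f _ (inj₁ (<-≤-trans (toℕ<n j) (r .4≤x)))) (r .params j)
  represents-frame f r .heap a = trans (f _ (inj₂ (m≤m+n R a))) (r .heap a)

  represents-bind : ∀ {m x} {loc ρ : Vec ℕ m} {M v} → M x ≡ v → Represents x loc ρ M →
                    Represents (1 + x) (x ∷ loc) (v ∷ ρ) M
  represents-bind eq r .4≤x = m≤n⇒m≤1+n (r .4≤x)
  represents-bind eq r .loc<x zero = ≤-refl
  represents-bind eq r .loc<x (suc i) = m≤n⇒m≤1+n (r .loc<x i)
  represents-bind eq r .locals zero = eq
  represents-bind eq r .locals (suc i) = r .locals i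
  represents-bind eq r .params = r .params
  represents-bind eq r .heap = r .heap

  Result : ℕ → ℕ → Memory → Memory → Set
  Result x v M M′ = M′ x ≡ v × Frame x M M′

  frame-refl : ∀ {x M} → Frame x M M
  frame-refl c _ = refl

  private
    fetch : ∀ {M x y v} → y < x → x < R → M y ≡ v →
            Exec (const x 0 ⨟ add x x y) M 2 (Result x v M)
    fetch {x = x} y<x x<R eq =
      exec-const ⟫ λ {M₁} w@(e , o) →
      exec-map (λ w′ → proj₁ w′ , frame-write ≤-refl x<R (frame-write ≤-refl x<R frame-refl w) w′)
        (exec-add (trans (cong₂ _+_ e (o _ (<⇒≢ y<x))) eq))

  compile-correct : ∀ {m} Z (e : Expr m) {loc ρ x M} → top e x ≤ R →
                    Represents x loc ρ M → Safe Z e H γ ρ →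
                    Exec (compile R e loc x) M (time e Z) (Result x (⟦ e ⟧ H γ ρ) M)

  private
    operands : ∀ {m} Z (a b : Expr m) {loc ρ x M} → top a x ≤ R → top b (1 + x) ≤ R →
               Represents x loc ρ M → Safe Z a H γ ρ → Safe Z b H γ ρ →
               ∀ {P T Q} → (∀ {M′} → M′ x ≡ ⟦ a ⟧ H γ ρ → M′ (1 + x) ≡ ⟦ b ⟧ H γ ρ → Frame x M M′ → Exec P M′ T Q) →
               Exec (compile R a loc x ⨟ compile R b loc (1 + x) ⨟ P) M (time a Z + (time b Z + T)) Q
    operands Z a b ta tb r sa sb k =
      compile-correct Z a ta r sa ⟫ λ (ea , fa) →
      compile-correct Z b tb (represents-mono (n≤1+n _) (represents-frame fa r)) sb ⟫ λ (eb , fb) →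
      k (trans (fb _ (inj₁ ≤-refl)) ea) eb (frame-trans (n≤1+n _) fa fb)

  compile-correct Z (var i) t r s = fetch (r .loc<x i) t (r .locals i)
  compile-correct Z (par j) t r s = fetch (<-≤-trans (toℕ<n j) (r .4≤x)) t (r .params j)
  compile-correct Z (lit c) t r s =
    exec-map (λ w → proj₁ w , frame-write ≤-refl t frame-refl w) exec-const
  compile-correct Z (a ⊕ b) {x = x} t r (sa , sb) =
    operands Z a b (m⊔n≤o⇒m≤o _ _ t) (m⊔n≤o⇒n≤o _ _ t) r sa sb λ ea eb f →
    exec-map (λ w → proj₁ w , frame-write ≤-refl (<-≤-trans (<top (a ⊕ b) x) t) f w)
      (exec-add (cong₂ _+_ ea eb))
  compile-correct Z (a ⊖ b) {x = x} t r (sa , sb) =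
    operands Z a b (m⊔n≤o⇒m≤o _ _ t) (m⊔n≤o⇒n≤o _ _ t) r sa sb λ ea eb f →
    exec-map (λ w → proj₁ w , frame-write ≤-refl (<-≤-trans (<top (a ⊖ b) x) t) f w)
      (exec-sub (cong₂ _∸_ ea eb))
  -- Only the left factor counts rounds; the right one is added as a whole in each round and may be
  -- arbitrarily large.
  compile-correct Z (a ⊗ b) {ρ = ρ} {x} {M₀} t r (sa , sb , a≤Z) =
    operands Z a b (m⊔n≤o⇒m≤o _ _ t′) (m⊔n≤o⇒n≤o _ _ t′) r sa sb λ ea eb f →
    exec-const ⟫ λ w₁@(e₁ , o₁) →
    exec-const ⟫ λ w₂@(e₂ , o₂) →
    exec-≤ (s≤s (*-monoˡ-≤ 3 a≤Z)) (exec-while I proj₁ body A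
      ( trans (o₂ x x≢3+x) (trans (o₁ x x≢2+x) ea)
      , trans (o₂ _ 1+x≢3+x) (trans (o₁ _ x≢1+x′) eb)
      , cong (_+ A * B) (trans (o₂ _ 2+x≢3+x) e₁)
      , e₂
      , frame-write (m≤n+m x 3) x3<R (frame-write (m≤n+m x 2) x2<R f w₁) w₂)) ⟫ λ {M₁} (e0 , _ , e2 , _ , f′) →
    exec-map (λ w → proj₁ w , frame-write ≤-refl x<R f′ w)
      (exec-add (trans (cong (_+ M₁ (2 + x)) e0) (trans (sym (+-identityʳ _)) e2)))
    where
    A = ⟦ a ⟧ H γ ρ
    B = ⟦ b ⟧ H γ ρ
    t′ = m⊔n≤o⇒m≤o (top a x ⊔ top b (1 + x)) _ t
    x3<R = m⊔n≤o⇒n≤o (top a x ⊔ top b (1 + x)) (4 + x) t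
    x2<R = <-trans (n<1+n _) x3<R
    x<R = <-≤-trans (<top (a ⊗ b) x) t
    x≢3+x : x ≢ 3 + x
    x≢3+x = <⇒≢ (m≤n+m (1 + x) 2)
    x≢2+x : x ≢ 2 + x
    x≢2+x = <⇒≢ (m≤n+m (1 + x) 1)
    1+x≢3+x : 1 + x ≢ 3 + x
    1+x≢3+x = <⇒≢ (m≤n+m (2 + x) 1)
    x≢1+x′ : 1 + x ≢ 2 + x
    x≢1+x′ = <⇒≢ ≤-refl
    2+x≢3+x : 2 + x ≢ 3 + x
    2+x≢3+x = <⇒≢ ≤-refl
    I : ℕ → Memory → Set
    I i M = M x ≡ i × M (1 + x) ≡ B × M (2 + x) + i * B ≡ A * B × M (3 + x) ≡ 1 × Frame x M₀ M
    body : ∀ {i M} → I (suc i) M → Exec (add (2 + x) (2 + x) (1 + x) ⨟ sub x x (3 + x)) M 2 (I i)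
    body {i} {M} (e0 , e1 , e2 , e3 , f) =
      exec-add refl ⟫ λ w₁@(e₁ , o₁) →
      exec-map (λ w₂@(e₂ , o₂) →
          e₂
        , trans (o₂ _ 1+n≢n) (trans (o₁ _ x≢1+x′) e1)
        , trans (cong (_+ i * B) (trans (o₂ _ (≢-sym x≢2+x)) (trans e₁ (cong (M (2 + x) +_) e1))))
                (trans (+-assoc (M (2 + x)) B (i * B)) e2)
        , trans (o₂ _ (≢-sym x≢3+x)) (trans (o₁ _ 1+n≢n) e3)
        , frame-write ≤-refl x<R (frame-write (m≤n+m x 2) x2<R f w₁) w₂)
        (exec-sub (cong₂ _∸_ (trans (o₁ _ x≢2+x) e0) (trans (o₁ _ 1+n≢n) e3)))
  compile-correct Z (get a) {x = x} t r s =
    compile-correct Z a (m⊔n≤o⇒m≤o _ _ t) r s ⟫ λ (ea , f) →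
    exec-const ⟫ λ w₁@(e₁ , o₁) →
    exec-add (cong₂ _+_ e₁ (trans (o₁ x (<⇒≢ ≤-refl)) ea)) ⟫ λ {M₂} w₂@(e₂ , _) →
    let f′ = frame-write ≤-refl x<R (frame-write (n≤1+n x) (m⊔n≤o⇒n≤o (top a x) _ t) f w₁) w₂ in
    exec-map (λ w → proj₁ w , frame-write ≤-refl x<R f′ w)
      (exec-load (trans (cong M₂ e₂) (represents-frame f′ r .heap _)))
    where
    x<R = <-≤-trans (<top (get a) x) t
  compile-correct Z (guard a b) {loc} {ρ} {x} {M₀} t r (sa , sb) =
    compile-correct Z a (m⊔n≤o⇒m≤o _ _ t) r sa ⟫ λ (ea , f) → branch (⟦ a ⟧ H γ ρ) sb ea f
    where
    -- For `v = 0` the cell already holds the result, and the test and `skip` cost the 2 steps of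
    -- the bound.
    branch : ∀ v {M₁} → (0 < v → Safe Z b H γ ρ) → M₁ x ≡ v → Frame x M₀ M₁ →
             Exec (ifnz x (compile R b loc x) skip) M₁ (2 + time b Z) (Result x (guardℕ v (⟦ b ⟧ H γ ρ)) M₀)
    branch zero sb ea f = 2 , _ , ifnz₀ ea skip , s≤s (s≤s z≤n) , ea , f
    branch (suc v) sb ea f
      with compile-correct Z b (m⊔n≤o⇒n≤o (top a x) _ t) (represents-frame f r) (sb (s≤s z≤n))
    ... | s , M′ , r′ , s≤ , e , f′ =
      suc s , M′ , ifnz₊ (λ e0 → 1+n≢0 (trans (sym ea) e0)) r′ , s≤s (m≤n⇒m≤1+n s≤) , e , frame-trans ≤-refl f f′
  compile-correct Z (sum a b) {loc} {ρ} {x} {M₀} t r (sa , a≤Z , sb) =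
    compile-correct Z a (m⊔n≤o⇒m≤o _ _ t) r sa ⟫ λ (ea , f) →
    exec-const ⟫ λ w₁@(e₁ , o₁) →
    exec-≤ (s≤s (*-monoˡ-≤ _ a≤Z)) (exec-while I proj₁ body N
      ( trans (o₁ _ (<⇒≢ ≤-refl)) ea , ≤-refl
      , cong (_+ sumTo N F) e₁
      , frame-write (n≤1+n x) x1<R f w₁)) ⟫ λ {M₁} (e0 , _ , e1 , f′) →
    exec-map (λ w → proj₁ w , frame-write ≤-refl x<R f′ w)
      (exec-add (trans (cong (_+ M₁ (1 + x)) e0) (trans (sym (+-identityʳ _)) e1)))
    where
    N = ⟦ a ⟧ H γ ρ
    F : ℕ → ℕ
    F i = ⟦ b ⟧ H γ (i ∷ ρ)
    tb = m⊔n≤o⇒n≤o (top a x) (top b (2 + x)) t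
    x2<R = <-≤-trans (<top b (2 + x)) tb
    x1<R = <-trans (n<1+n _) x2<R
    x<R = <-trans (n<1+n _) x1<R
    I : ℕ → Memory → Set
    I i M = M x ≡ i × i ≤ N × M (1 + x) + sumTo i F ≡ sumTo N F × Frame x M₀ M
    body : ∀ {i M} → I (suc i) M →
           Exec (const (2 + x) 1 ⨟ sub x x (2 + x) ⨟ compile R b (x ∷ loc) (2 + x) ⨟ add (1 + x) (1 + x) (2 + x))
             M (1 + (1 + (time b Z + 1))) (I i)
    body {i} {M} (e0 , i<N , e1 , f) =
      exec-const ⟫ λ w₁@(e₁ , o₁) →
      exec-sub (cong₂ _∸_ (trans (o₁ _ (<⇒≢ (m≤n+m (1 + x) 1))) e0) e₁) ⟫ λ w₂@(e₂ , o₂) →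
      let f₁ = frame-write ≤-refl x<R (frame-write (m≤n+m x 2) x2<R f w₁) w₂ in
      compile-correct Z b tb (represents-mono (n≤1+n _) (represents-bind e₂ (represents-frame f₁ r))) (sb i i<N) ⟫ λ (e₃ , f₂) →
      exec-map (λ w₃@(e₄ , o₃) →
          trans (o₃ _ (<⇒≢ ≤-refl)) (trans (f₂ x (inj₁ (m≤n+m (1 + x) 1))) e₂)
        , <⇒≤ i<N
        , trans (cong (_+ sumTo i F) e₄) (trans (+-assoc (M (1 + x)) (F i) (sumTo i F)) e1)
        , frame-write (n≤1+n x) x1<R (frame-trans (m≤n+m x 2) f₁ f₂) w₃)
        (exec-add (cong₂ _+_ (trans (f₂ _ (inj₁ ≤-refl)) (trans (o₂ _ 1+n≢n) (o₁ _ (<⇒≢ ≤-refl)))) e₃))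

-- Bounded formulas

data Formula (m : ℕ) : Set where
  _≺_ _≐_       : Expr m → Expr m → Formula m
  ¬ᶠ_           : Formula m → Formula m
  _∧ᶠ_ _∨ᶠ_ _⇒_ : Formula m → Formula m → Formula m
  ∃ᶠ ∀ᶠ         : Expr m → Formula (suc m) → Formula m

infix  5 _≺_ _≐_
infix  4 ¬ᶠ_
infixr 3 _∧ᶠ_
infixr 2 _∨ᶠ_
infixr 1 _⇒_

Holds : ∀ {m} → Formula m → Heap → Vec ℕ 4 → Vec ℕ m → Set
Holds (a ≺ b)  H γ ρ = ⟦ a ⟧ H γ ρ < ⟦ b ⟧ H γ ρ
Holds (a ≐ b)  H γ ρ = ⟦ a ⟧ H γ ρ ≡ ⟦ b ⟧ H γ ρ
Holds (¬ᶠ φ)   H γ ρ = ¬ Holds φ H γ ρ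
Holds (φ ∧ᶠ ψ) H γ ρ = Holds φ H γ ρ × Holds ψ H γ ρ
Holds (φ ∨ᶠ ψ) H γ ρ = Holds φ H γ ρ ⊎ Holds ψ H γ ρ
Holds (φ ⇒ ψ)  H γ ρ = Holds φ H γ ρ → Holds ψ H γ ρ
Holds (∃ᶠ a φ) H γ ρ = ∃[ i ] i < ⟦ a ⟧ H γ ρ × Holds φ H γ (i ∷ ρ)
Holds (∀ᶠ a φ) H γ ρ = ∀ i → i < ⟦ a ⟧ H γ ρ → Holds φ H γ (i ∷ ρ)

-- Truth is coded by positivity rather than by the value 1. Comparison is then truncated
-- subtraction, disjunction addition and existence a sum, while `lit 1 ⊖_` negates. Conjunction uses
-- `guard` instead of a product, so that the second formula is evaluated only if the first one
-- holds.
indicator : ∀ {m} → Formula m → Expr m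
indicator (a ≺ b)  = b ⊖ a
indicator (a ≐ b)  = lit 1 ⊖ ((a ⊖ b) ⊕ (b ⊖ a))
indicator (¬ᶠ φ)   = lit 1 ⊖ indicator φ
indicator (φ ∧ᶠ ψ) = guard (indicator φ) (indicator ψ)
indicator (φ ∨ᶠ ψ) = indicator φ ⊕ indicator ψ
indicator (φ ⇒ ψ)  = lit 1 ⊖ guard (indicator φ) (lit 1 ⊖ indicator ψ)
indicator (∃ᶠ a φ) = sum a (indicator φ)
indicator (∀ᶠ a φ) = lit 1 ⊖ sum a (lit 1 ⊖ indicator φ)

sumTo-positive : ∀ {f} n {i} → i < n → 0 < f i → 0 < sumTo n f
sumTo-positive {f} (suc n) {i} i<1+n p with i ≟ n
... | yes refl = ≤-trans p (m≤m+n _ _)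
... | no  i≢n  = ≤-trans (sumTo-positive n (≤∧≢⇒< (≤-pred i<1+n) i≢n) p) (m≤n+m _ (f n))

sumTo-positive⁻¹ : ∀ {f} n → 0 < sumTo n f → ∃[ i ] i < n × 0 < f i
sumTo-positive⁻¹ {f} (suc n) p with f n in eq
... | suc _ = n , ≤-refl , subst (0 <_) (sym eq) (s≤s z≤n)
... | zero with sumTo-positive⁻¹ n p
...   | i , i<n , q = i , m≤n⇒m≤1+n i<n , q

0<1∸⇒≡0 : ∀ {a} → 0 < 1 ∸ a → a ≡ 0
0<1∸⇒≡0 {zero}  _ = refl
0<1∸⇒≡0 {suc a} p rewrite 0∸n≡0 a = ⊥-elim (n≮0 p)

≡0⇒0<1∸ : ∀ {a} → a ≡ 0 → 0 < 1 ∸ a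
≡0⇒0<1∸ refl = s≤s z≤n

¬0<⇒≡0 : ∀ {a} → ¬ 0 < a → a ≡ 0
¬0<⇒≡0 ¬p = n≤0⇒n≡0 (≮⇒≥ ¬p)

≡0⇒¬0< : ∀ {a} → a ≡ 0 → ¬ 0 < a
≡0⇒¬0< refl ()

0<guard : ∀ {a b} → 0 < a → 0 < b → 0 < guardℕ a b
0<guard {suc _} _ q = q

0<guard⁻¹ : ∀ {a b} → 0 < guardℕ a b → 0 < a × 0 < b
0<guard⁻¹ {suc _} q = s≤s z≤n , q

0<m∸n⇒n<m : ∀ {m n} → 0 < m ∸ n → n < m
0<m∸n⇒n<m {m} {n} p = ≰⇒> λ m≤n → <-irrefl (sym (m≤n⇒m∸n≡0 m≤n)) p

-- The two directions are proved simultaneously because negations and premises exchange them.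
holds⇒ : ∀ {m} (φ : Formula m) {H γ ρ} → Holds φ H γ ρ → 0 < ⟦ indicator φ ⟧ H γ ρ
holds⇐ : ∀ {m} (φ : Formula m) {H γ ρ} → 0 < ⟦ indicator φ ⟧ H γ ρ → Holds φ H γ ρ

holds⇒ (a ≺ b)  h = m<n⇒0<n∸m h
holds⇒ (a ≐ b)  h = ≡0⇒0<1∸ (cong₂ _+_ (m≤n⇒m∸n≡0 (≤-reflexive h)) (m≤n⇒m∸n≡0 (≤-reflexive (sym h))))
holds⇒ (¬ᶠ φ)   h = ≡0⇒0<1∸ (¬0<⇒≡0 λ p → h (holds⇐ φ p))
holds⇒ (φ ∧ᶠ ψ) (h , h′) = 0<guard (holds⇒ φ h) (holds⇒ ψ h′)
holds⇒ (φ ∨ᶠ ψ) (inj₁ h) = ≤-trans (holds⇒ φ h) (m≤m+n _ _)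
holds⇒ (φ ∨ᶠ ψ) (inj₂ h) = ≤-trans (holds⇒ ψ h) (m≤n+m _ _)
holds⇒ (φ ⇒ ψ)  h = ≡0⇒0<1∸ (¬0<⇒≡0 λ p → let (q , r) = 0<guard⁻¹ p in
  ≡0⇒¬0< (0<1∸⇒≡0 r) (holds⇒ ψ (h (holds⇐ φ q))))
holds⇒ (∃ᶠ a φ) (i , i< , h) = sumTo-positive _ i< (holds⇒ φ h)
holds⇒ (∀ᶠ a φ) {H} {γ} {ρ} h = ≡0⇒0<1∸ (¬0<⇒≡0 λ p →
  let (i , i< , q) = sumTo-positive⁻¹ (⟦ a ⟧ H γ ρ) p in ≡0⇒¬0< (0<1∸⇒≡0 q) (holds⇒ φ (h i i<)))

holds⇐ (a ≺ b)  p = 0<m∸n⇒n<m p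
holds⇐ (a ≐ b)  p = let e = 0<1∸⇒≡0 p in
  ≤-antisym (m∸n≡0⇒m≤n (m+n≡0⇒m≡0 _ e)) (m∸n≡0⇒m≤n (m+n≡0⇒n≡0 _ e))
holds⇐ (¬ᶠ φ)   p h = ≡0⇒¬0< (0<1∸⇒≡0 p) (holds⇒ φ h)
holds⇐ (φ ∧ᶠ ψ) p = let (q , r) = 0<guard⁻¹ p in holds⇐ φ q , holds⇐ ψ r
holds⇐ (φ ∨ᶠ ψ) {H} {γ} {ρ} p with ⟦ indicator φ ⟧ H γ ρ in eq
... | suc _ = inj₁ (holds⇐ φ (subst (0 <_) (sym eq) (s≤s z≤n)))
... | zero  = inj₂ (holds⇐ ψ p)
holds⇐ (φ ⇒ ψ)  {H} {γ} {ρ} p h with 0 <? ⟦ indicator ψ ⟧ H γ ρ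
... | yes q = holds⇐ ψ q
... | no ¬q = ⊥-elim (≡0⇒¬0< (0<1∸⇒≡0 p) (0<guard (holds⇒ φ h) (≡0⇒0<1∸ (¬0<⇒≡0 ¬q))))
holds⇐ (∃ᶠ a φ) {H} {γ} {ρ} p = let (i , i< , q) = sumTo-positive⁻¹ (⟦ a ⟧ H γ ρ) p in i , i< , holds⇐ φ q
holds⇐ (∀ᶠ a φ) {H} {γ} {ρ} p i i< with 0 <? ⟦ indicator φ ⟧ H γ (i ∷ ρ)
... | yes q = holds⇐ φ q
... | no ¬q = ⊥-elim (≡0⇒¬0< (0<1∸⇒≡0 p) (sumTo-positive _ i< (≡0⇒0<1∸ (¬0<⇒≡0 ¬q))))

-- Lazy evaluation is reflected here: the second part of a conjunction or implication has to be safe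
-- only where the first part holds. A range test can thus license the lookup behind it.
SafeFormula : ∀ {m} → ℕ → Formula m → Heap → Vec ℕ 4 → Vec ℕ m → Set
SafeFormula Z (a ≺ b)  H γ ρ = Safe Z a H γ ρ × Safe Z b H γ ρ
SafeFormula Z (a ≐ b)  H γ ρ = Safe Z a H γ ρ × Safe Z b H γ ρ
SafeFormula Z (¬ᶠ φ)   H γ ρ = SafeFormula Z φ H γ ρ
SafeFormula Z (φ ∧ᶠ ψ) H γ ρ = SafeFormula Z φ H γ ρ × (Holds φ H γ ρ → SafeFormula Z ψ H γ ρ)
SafeFormula Z (φ ∨ᶠ ψ) H γ ρ = SafeFormula Z φ H γ ρ × SafeFormula Z ψ H γ ρ
SafeFormula Z (φ ⇒ ψ)  H γ ρ = SafeFormula Z φ H γ ρ × (Holds φ H γ ρ → SafeFormula Z ψ H γ ρ)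
SafeFormula Z (∃ᶠ a φ) H γ ρ = Safe Z a H γ ρ × ⟦ a ⟧ H γ ρ ≤ Z ×
                               (∀ i → i < ⟦ a ⟧ H γ ρ → SafeFormula Z φ H γ (i ∷ ρ))
SafeFormula Z (∀ᶠ a φ) H γ ρ = Safe Z a H γ ρ × ⟦ a ⟧ H γ ρ ≤ Z ×
                               (∀ i → i < ⟦ a ⟧ H γ ρ → SafeFormula Z φ H γ (i ∷ ρ))

indicator-safe : ∀ {m Z} (φ : Formula m) {H γ ρ} → SafeFormula Z φ H γ ρ → Safe Z (indicator φ) H γ ρ
indicator-safe (a ≺ b)  (s , s′) = s′ , s
indicator-safe (a ≐ b)  (s , s′) = _ , (s , s′) , (s′ , s)
indicator-safe (¬ᶠ φ)   s = _ , indicator-safe φ s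
indicator-safe (φ ∧ᶠ ψ) (s , s′) = indicator-safe φ s , λ p → indicator-safe ψ (s′ (holds⇐ φ p))
indicator-safe (φ ∨ᶠ ψ) (s , s′) = indicator-safe φ s , indicator-safe ψ s′
indicator-safe (φ ⇒ ψ)  (s , s′) = _ , indicator-safe φ s , λ p → _ , indicator-safe ψ (s′ (holds⇐ φ p))
indicator-safe (∃ᶠ a φ) (s , a≤ , s′) = s , a≤ , λ i i< → indicator-safe φ (s′ i i<)
indicator-safe (∀ᶠ a φ) (s , a≤ , s′) = _ , s , a≤ , λ i i< → _ , indicator-safe φ (s′ i i<)

-- Relocating the input

bit : ℕ → (ℕ → Program) → Program
bit i P = ifnz i (P 1) (P 0)

exec-bit : ∀ {P M T Q} i v → M i ≡ v → v ≤ 1 → Exec (P v) M T Q → Exec (bit i P) M (suc T) Q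
exec-bit i zero          eq _ (t , M′ , r , t≤ , q) = suc t , M′ , ifnz₀ eq r , s≤s t≤ , q
exec-bit i (suc zero)    eq _ (t , M′ , r , t≤ , q) =
  suc t , M′ , ifnz₊ (λ e0 → 1+n≢0 (trans (sym eq) e0)) r , s≤s t≤ , q
exec-bit i (suc (suc v)) eq (s≤s ())

initial-beyond : ∀ xs {a} → length xs ≤ a → initial xs a ≡ 0
initial-beyond []       _       = refl
initial-beyond (x ∷ xs) (s≤s l) = initial-beyond xs l

square : Program
square = const 3 1 ⨟ const 4 0 ⨟ const 5 0 ⨟ add 5 5 2 ⨟ while 5 (add 4 4 2 ⨟ sub 5 5 3)

-- Source and target overlap and the target lies higher, so the highest cell has to be copied first.
-- The counter exceeds the index by one, whence the offsets 2 and `R ∸ 1` instead of 3 and `R`.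
shift : ℕ → Program
shift R = while 4 (const 5 2 ⨟ add 5 5 4 ⨟ load 5 5 ⨟ const 6 (R ∸ 1) ⨟ add 6 6 4 ⨟ store 6 5 ⨟ sub 4 4 3)

relocateWith : ℕ → ℕ → ℕ → ℕ → ℕ → Program
relocateWith R b₀ b₁ b₂ b₃ =
  square ⨟ shift R ⨟ const R b₀ ⨟ const (1 + R) b₁ ⨟ const (2 + R) b₂ ⨟ const (3 + R) b₃

-- The matrix starts at cell 3 and leaves no free cell with a fixed address.  The bits
-- of cells 3 to 6 are therefore first moved into the control flow.
relocate : ℕ → Program
relocate R =
  bit 3 λ b₀ → bit 4 λ b₁ → bit 5 λ b₂ → bit 6 λ b₃ → relocateWith R b₀ b₁ b₂ b₃

relocate-time : ℕ → ℕ
relocate-time Z = 4 + ((1 + (1 + (1 + (1 + (1 + Z * 3))))) + ((1 + Z * 8) + (1 + (1 + (1 + 1)))))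

module Relocation (R : ℕ) (7≤R : 7 ≤ R) (k d n : ℕ) (bits : List ℕ)
                  (boolean : ∀ a → initial bits a ≤ 1) (len : length bits ≡ n * n) where

  M₀ : Memory
  M₀ = initial (k ∷ d ∷ n ∷ bits)

  Inputs : Memory → Set
  Inputs M = M 0 ≡ k × M 1 ≡ d × M 2 ≡ n

  above : ∀ {x} c → x < 7 → 7 ≤ c → c ≢ x
  above c x<7 7≤c = ≢-sym (<⇒≢ (<-≤-trans x<7 7≤c))

  Squared : Memory → Set
  Squared M = Inputs M × M 3 ≡ 1 × M 4 ≡ n * n × (∀ c → 7 ≤ c → M c ≡ M₀ c)

  square-correct : ∀ Z → n ≤ Z → Exec square M₀ (1 + (1 + (1 + (1 + (1 + Z * 3))))) Squared
  square-correct Z n≤Z =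
    exec-const ⟫ λ (e₁ , o₁) →
    exec-const ⟫ λ (e₂ , o₂) →
    exec-const ⟫ λ (e₃ , o₃) →
    exec-add {v = n} (cong₂ _+_ e₃ (trans (o₃ 2 λ ()) (trans (o₂ 2 λ ()) (o₁ 2 λ ())))) ⟫ λ (e₄ , o₄) →
    exec-≤ (s≤s (*-monoˡ-≤ 3 n≤Z)) (exec-map (λ (i , _ , e3 , e4 , o) → i , e3 , trans (sym (+-identityʳ _)) e4 , o)
      (exec-while I (λ (_ , e , _) → e) body n
        ( (trans (o₄ 0 λ ()) (trans (o₃ 0 λ ()) (trans (o₂ 0 λ ()) (o₁ 0 λ ())))
        ,  trans (o₄ 1 λ ()) (trans (o₃ 1 λ ()) (trans (o₂ 1 λ ()) (o₁ 1 λ ())))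
        ,  trans (o₄ 2 λ ()) (trans (o₃ 2 λ ()) (trans (o₂ 2 λ ()) (o₁ 2 λ ()))))
        , e₄
        , trans (o₄ 3 λ ()) (trans (o₃ 3 λ ()) (trans (o₂ 3 λ ()) e₁))
        , cong (_+ n * n) (trans (o₄ 4 λ ()) (trans (o₃ 4 λ ()) e₂))
        , λ c h → trans (o₄ c (above c (m≤m+n 6 1) h)) (trans (o₃ c (above c (m≤m+n 6 1) h))
            (trans (o₂ c (above c (m≤m+n 5 2) h)) (o₁ c (above c (m≤m+n 4 3) h)))))))
    where
    I : ℕ → Memory → Set
    I i M = Inputs M × M 5 ≡ i × M 3 ≡ 1 × M 4 + i * n ≡ n * n × (∀ c → 7 ≤ c → M c ≡ M₀ c)
    body : ∀ {i M} → I (suc i) M → Exec (add 4 4 2 ⨟ sub 5 5 3) M 2 (I i)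
    body {i} {M} ((e0 , e1 , e2) , e5 , e3 , e4 , o) =
      exec-add refl ⟫ λ (e₁ , o₁) →
      exec-map (λ (e₂ , o₂) →
          ( trans (o₂ 0 λ ()) (trans (o₁ 0 λ ()) e0)
          , trans (o₂ 1 λ ()) (trans (o₁ 1 λ ()) e1)
          , trans (o₂ 2 λ ()) (trans (o₁ 2 λ ()) e2))
        , e₂ , trans (o₂ 3 λ ()) (trans (o₁ 3 λ ()) e3)
        , trans (cong (_+ i * n) (trans (o₂ 4 λ ()) (trans e₁ (cong (M 4 +_) e2)))) (trans (+-assoc (M 4) n (i * n)) e4)
        , λ c h → trans (o₂ c (above c (m≤m+n 6 1) h)) (trans (o₁ c (above c (m≤m+n 5 2) h)) (o c h)))
        (exec-sub (cong₂ _∸_ (trans (o₁ 5 λ ()) e5) (trans (o₁ 3 λ ()) e3)))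

  -- The entries 0 to 3 are excluded: their sources, the cells 3 to 6, have become work cells. They
  -- are restored afterwards from the control flow.
  Shifted : Memory → Set
  Shifted M = Inputs M × (∀ a → 4 ≤ a → M (R + a) ≡ initial bits a)

  shift-correct : ∀ Z {M} → n * n ≤ Z → Squared M → Exec (shift R) M (1 + Z * 8) Shifted
  shift-correct Z {M} nn≤Z (i , e3 , e4 , o) =
    exec-≤ (s≤s (*-monoˡ-≤ 8 nn≤Z)) (exec-map (λ (i , _ , _ , _ , new) → i , λ a → new a z≤n)
      (exec-while I (λ (_ , _ , e , _) → e) body (n * n)
        (i , e3 , e4 , (λ c h _ → o c h) ,
         -- Beyond the matrix both sides are 0, so these cells are correct before the first move.
         λ a n²≤a _ → trans (o (R + a) (≤-trans 7≤R (m≤m+n R a)))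
                        (trans (initial-beyond (k ∷ d ∷ n ∷ bits)
                                 (≤-trans (+-monoʳ-≤ 3 (≤-trans (≤-reflexive len) n²≤a)) (+-monoˡ-≤ a (≤-trans (m≤m+n 3 4) 7≤R))))
                          (sym (initial-beyond bits (≤-trans (≤-reflexive len) n²≤a)))))))
    where
    R≡ : suc (R ∸ 1) ≡ R
    R≡ = m+[n∸m]≡n (≤-trans (m≤m+n 1 6) 7≤R)
    I : ℕ → Memory → Set
    I i M = Inputs M × M 3 ≡ 1 × M 4 ≡ i × (∀ c → 7 ≤ c → c < R + i → M c ≡ M₀ c) ×
            (∀ a → i ≤ a → 4 ≤ a → M (R + a) ≡ initial bits a)
    body : ∀ {i M} → I (suc i) M →
           Exec (const 5 2 ⨟ add 5 5 4 ⨟ load 5 5 ⨟ const 6 (R ∸ 1) ⨟ add 6 6 4 ⨟ store 6 5 ⨟ sub 4 4 3) M 7 (I i)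
    body {i} {M} ((e0 , e1 , e2) , e3 , e4 , old , new) =
      exec-const ⟫ λ (e₁ , o₁) →
      exec-add (cong₂ _+_ e₁ (trans (o₁ 4 λ ()) e4)) ⟫ λ {M₂} (e₂ , o₂) →
      exec-load {v = M₂ (3 + i)} (cong M₂ e₂) ⟫ λ (e₃ , o₃) →
      exec-const ⟫ λ (e₄ , o₄) →
      exec-add {v = R + i} (trans (cong₂ _+_ e₄ (trans (o₄ 4 λ ()) (trans (o₃ 4 λ ()) (trans (o₂ 4 λ ()) (trans (o₁ 4 λ ()) e4)))))
                 (trans (+-suc (R ∸ 1) i) (cong (_+ i) R≡))) ⟫ λ (e₅ , o₅) →
      exec-store e₅ refl ⟫ λ {M₆} (e₆ , o₆) →
      let low : ∀ x → x < 7 → x ≢ R + i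
          low x x<7 = <⇒≢ (<-≤-trans x<7 (≤-trans 7≤R (m≤m+n R i)))
          keep : ∀ {c} → 7 ≤ c → c ≢ R + i → _ ≡ M c
          keep {c} h c≢ = trans (o₆ c c≢) (trans (o₅ c (above c (m≤m+n 7 0) h)) (trans (o₄ c (above c (m≤m+n 7 0) h))
                   (trans (o₃ c (above c (m≤m+n 6 1) h)) (trans (o₂ c (above c (m≤m+n 6 1) h)) (o₁ c (above c (m≤m+n 6 1) h))))))
          keep′ : ∀ x → x < 5 → _ ≡ M x
          keep′ x h = trans (o₆ x (low x (≤-trans h (m≤m+n 5 2))))
                        (trans (o₅ x (<⇒≢ (≤-trans h (m≤m+n 5 1)))) (trans (o₄ x (<⇒≢ (≤-trans h (m≤m+n 5 1))))
                          (trans (o₃ x (<⇒≢ h)) (trans (o₂ x (<⇒≢ h)) (o₁ x (<⇒≢ h))))))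
      in
      exec-map (λ (e₇ , o₇) →
          ( trans (o₇ 0 λ ()) (trans (keep′ 0 (m≤m+n 1 4)) e0) , trans (o₇ 1 λ ()) (trans (keep′ 1 (m≤m+n 2 3)) e1)
          , trans (o₇ 2 λ ()) (trans (keep′ 2 (m≤m+n 3 2)) e2))
        , trans (o₇ 3 λ ()) (trans (keep′ 3 (m≤m+n 4 1)) e3)
        , e₇
        , (λ c h c<R+i → trans (o₇ c (above c (m≤m+n 5 2) h))
             (trans (keep h (<⇒≢ c<R+i)) (old c h (≤-trans c<R+i (+-monoʳ-≤ R (n≤1+n i))))))
        , λ a i≤a 4≤a → trans (o₇ (R + a) (above _ (m≤m+n 5 2) (≤-trans 7≤R (m≤m+n R a))))
            (written a i≤a 4≤a keep
               (λ a≡i → trans (cong M₆ (cong (R +_) a≡i)) (trans e₆ (trans (o₅ 5 λ ()) (trans (o₄ 5 λ ()) (trans e₃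
                 (trans (o₂ (3 + i) (above (3 + i) (m≤m+n 6 1) (+-monoʳ-≤ 3 (≤-trans 4≤a (≤-reflexive a≡i)))))
                   (trans (o₁ (3 + i) (above (3 + i) (m≤m+n 6 1) (+-monoʳ-≤ 3 (≤-trans 4≤a (≤-reflexive a≡i)))))
                     (trans (old (3 + i) (+-monoʳ-≤ 3 (≤-trans 4≤a (≤-reflexive a≡i)))
                               (≤-<-trans (+-monoˡ-≤ i (≤-trans (m≤m+n 3 4) 7≤R)) (+-monoʳ-< R ≤-refl)))
                            (cong (initial bits) (sym a≡i))))))))))))
        (exec-sub (cong₂ _∸_ (trans (keep′ 4 (m≤m+n 5 0)) e4) (trans (keep′ 3 (m≤m+n 4 1)) e3)))
      where
      written : ∀ a → i ≤ a → 4 ≤ a → ∀ {M′ : Memory} → (∀ {c} → 7 ≤ c → c ≢ R + i → M′ c ≡ M c) →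
                (a ≡ i → M′ (R + a) ≡ initial bits a) → M′ (R + a) ≡ initial bits a
      written a i≤a 4≤a keep eq with a ≟ i
      ... | yes a≡i = eq a≡i
      ... | no  a≢i = trans (keep (≤-trans 7≤R (m≤m+n R a)) (λ e → a≢i (+-cancelˡ-≡ R a i e)))
                        (new a (≤∧≢⇒< i≤a (≢-sym a≢i)) 4≤a)

  Relocated : Memory → Set
  Relocated M = Inputs M × (∀ a → M (R + a) ≡ initial bits a)

  relocate-correct : ∀ Z → n ≤ Z → n * n ≤ Z → Exec (relocate R) M₀ (relocate-time Z) Relocated
  relocate-correct Z n≤Z nn≤Z =
    exec-bit {λ b₀ → bit 4 λ b₁ → bit 5 λ b₂ → bit 6 λ b₃ → relocateWith R b₀ b₁ b₂ b₃} 3 (b 0) refl (boolean 0)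
    (exec-bit {λ b₁ → bit 5 λ b₂ → bit 6 λ b₃ → relocateWith R (b 0) b₁ b₂ b₃} 4 (b 1) refl (boolean 1)
    (exec-bit {λ b₂ → bit 6 λ b₃ → relocateWith R (b 0) (b 1) b₂ b₃} 5 (b 2) refl (boolean 2)
    (exec-bit {λ b₃ → relocateWith R (b 0) (b 1) (b 2) b₃} 6 (b 3) refl (boolean 3)
      (square-correct Z n≤Z ⟫ λ sq →
       shift-correct Z nn≤Z sq ⟫ λ ((e0 , e1 , e2) , h) →
       exec-const ⟫ λ {M₁} (e₁ , o₁) → exec-const ⟫ λ {M₂} (e₂ , o₂) → exec-const ⟫ λ {M₃} (e₃ , o₃) →
       exec-map (λ {M₄} (e₄ , o₄) →
         let keep : ∀ c → c < R → _
             keep c c<R = trans (o₄ c (<⇒≢ (≤-trans c<R (m≤n+m R 3)))) (trans (o₃ c (<⇒≢ (≤-trans c<R (m≤n+m R 2))))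
                            (trans (o₂ c (<⇒≢ (≤-trans c<R (m≤n+m R 1)))) (o₁ c (<⇒≢ c<R))))
             R≢ : ∀ {i j} → i ≢ j → R + i ≢ j + R
             R≢ {i} {j} i≢j e = i≢j (+-cancelˡ-≡ R i j (trans e (+-comm j R)))
         in
           ( trans (keep 0 (≤-trans (m≤m+n 1 6) 7≤R)) e0
           , trans (keep 1 (≤-trans (m≤m+n 2 5) 7≤R)) e1
           , trans (keep 2 (≤-trans (m≤m+n 3 4) 7≤R)) e2)
         , λ { 0 → trans (o₄ _ (R≢ λ ())) (trans (o₃ _ (R≢ λ ())) (trans (o₂ _ (R≢ λ ())) (trans (cong M₁ (+-identityʳ R)) e₁)))
             ; 1 → trans (o₄ _ (R≢ λ ())) (trans (o₃ _ (R≢ λ ())) (trans (cong M₂ (+-comm R 1)) e₂))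
             ; 2 → trans (o₄ _ (R≢ λ ())) (trans (cong M₃ (+-comm R 2)) e₃)
             ; 3 → trans (cong M₄ (+-comm R 3)) e₄
             ; (suc (suc (suc (suc a)))) → trans (o₄ _ (R≢ λ ())) (trans (o₃ _ (R≢ λ ())) (trans (o₂ _ (R≢ λ ()))
                 (trans (o₁ (R + (4 + a)) (R≢ {4 + a} {0} λ ())) (h _ (m≤m+n 4 a))))) })
         exec-const))))
    where
    b : ℕ → ℕ
    b = initial bits

-- Tabulation

-- Fills the heap cells start, start + 1, …, each with the value of entry at its own
-- address (the fourth parameter), and then evaluates answer.
record Tabulation : Set where
  field
    start count entry answer : Expr 0

  -- The 7 reserves the work cells 0 to 6 of `relocate` and `fill`; the other terms keep all scratch
  -- space below the heap.
  tops : ℕ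
  tops = 7 ⊔ top start 4 ⊔ top count 4 ⊔ top entry 5 ⊔ top answer 4

  -- Cell 3 holds the address being filled and cell 4 the number of cells left, so the entry is
  -- evaluated from cell 5 upwards.
  fill : ℕ → Program
  fill R = while 4 (compile R entry [] 5 ⨟ const 6 R ⨟ add 6 6 3 ⨟ store 6 5 ⨟ const 6 1 ⨟ add 3 3 6 ⨟ sub 4 4 6)

  program : Program
  program =
    relocate tops ⨟
    compile tops start [] 4 ⨟ const 3 0 ⨟ add 3 3 4 ⨟ compile tops count [] 4 ⨟
    fill tops ⨟
    compile tops answer [] 4 ⨟ const 0 0 ⨟ add 0 0 4

  fill-time : ℕ → ℕ
  fill-time Z = 1 + Z * (1 + (time entry Z + 6))

  program-time : ℕ → ℕ
  program-time Z =
    relocate-time Z + (time start Z + (1 + (1 + (time count Z + (fill-time Z + (time answer Z + 2))))))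

  poly-program-time : PolynomiallyBounded program-time
  poly-program-time =
    poly-+ (poly-+ (poly-const 4) (poly-+ (poly-+ (poly-const 5) (poly-* poly-id (poly-const 3)))
                                          (poly-+ (poly-+ (poly-const 1) (poly-* poly-id (poly-const 8))) (poly-const 4))))
    (poly-+ (poly-time start) (poly-+ (poly-const 2) (poly-+ (poly-time count)
      (poly-+ (poly-+ (poly-const 1) (poly-* poly-id (poly-+ (poly-const 1) (poly-+ (poly-time entry) (poly-const 6)))))
        (poly-+ (poly-time answer) (poly-const 2))))))

module TabulationRun (T : Tabulation) (k d n : ℕ) (bits : List ℕ)
                     (boolean : ∀ a → initial bits a ≤ 1) (len : length bits ≡ n * n)
                     (S L : ℕ) where
  open Tabulation T

  params : ℕ → Vec ℕ 4
  params a = k ∷ d ∷ n ∷ a ∷ []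

  -- Each entry is evaluated in the heap left by its predecessors, so the table may be defined by
  -- recursion on addresses, as in dynamic programming.
  heapAt : ℕ → Heap
  heapAt zero    = initial bits
  heapAt (suc j) = heapAt j [ S + j ≔ ⟦ entry ⟧ (heapAt j) (params (S + j)) [] ]

  record Bounded (Z : ℕ) : Set where
    field
      n≤Z         : n ≤ Z
      n*n≤Z       : n * n ≤ Z
      L≤Z         : L ≤ Z
      -- Relocation leaves an unspecified number in cell 3, the fourth parameter; `start` must be
      -- insensitive to it.
      start-value : ∀ a → ⟦ start ⟧ (heapAt 0) (params a) [] ≡ S
      count-value : ⟦ count ⟧ (heapAt 0) (params S) [] ≡ L
      start-safe  : ∀ a → Safe Z start (heapAt 0) (params a) []
      count-safe  : Safe Z count (heapAt 0) (params S) []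
      entry-safe  : ∀ j → j < L → Safe Z entry (heapAt j) (params (S + j)) []
      answer-safe : Safe Z answer (heapAt L) (params (S + L)) []

  private
    R = tops

    answer≤ : top answer 4 ≤ R
    answer≤ = m≤n⊔m (7 ⊔ top start 4 ⊔ top count 4 ⊔ top entry 5) (top answer 4)
    entry≤ : top entry 5 ≤ R
    entry≤ = ≤-trans (m≤n⊔m (7 ⊔ top start 4 ⊔ top count 4) (top entry 5)) (m≤m⊔n _ (top answer 4))
    rest≤ : 7 ⊔ top start 4 ⊔ top count 4 ≤ R
    rest≤ = ≤-trans (m≤m⊔n _ (top entry 5)) (m≤m⊔n _ (top answer 4))
    count≤ : top count 4 ≤ R
    count≤ = ≤-trans (m≤n⊔m (7 ⊔ top start 4) (top count 4)) rest≤
    start≤ : top start 4 ≤ R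
    start≤ = ≤-trans (≤-trans (m≤n⊔m 7 (top start 4)) (m≤m⊔n _ (top count 4))) rest≤
    7≤R : 7 ≤ R
    7≤R = ≤-trans (≤-trans (m≤m⊔n 7 (top start 4)) (m≤m⊔n _ (top count 4))) rest≤

    State : Heap → ℕ → Memory → Set
    State H a M = M 0 ≡ k × M 1 ≡ d × M 2 ≡ n × M 3 ≡ a × (∀ b → M (R + b) ≡ H b)

    eval : ∀ {H a M x Z} (e : Expr 0) → 4 ≤ x → top e x ≤ R → State H a M → Safe Z e H (params a) [] →
           Exec (compile R e [] x) M (time e Z) (λ M′ → M′ x ≡ ⟦ e ⟧ H (params a) [] × State H a M′ × (∀ c → c < x → M′ c ≡ M c))
    eval {H} {a} {M} {x} {Z} e 4≤x t (e0 , e1 , e2 , e3 , h) s =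
      exec-map (λ (v , f) → v ,
          ( trans (f 0 (inj₁ (≤-trans (m≤m+n 1 3) 4≤x))) e0
          , trans (f 1 (inj₁ (≤-trans (m≤m+n 2 2) 4≤x))) e1
          , trans (f 2 (inj₁ (≤-trans (m≤m+n 3 1) 4≤x))) e2
          , trans (f 3 (inj₁ 4≤x)) e3
          , λ b → trans (f (R + b) (inj₂ (m≤m+n R b))) (h b))
        , λ c c<x → f c (inj₁ c<x))
        (compile-correct Z e t represents s)
      where
      open Compilation R H (params a)
      represents : Represents x [] [] M
      represents = record
        { 4≤x = 4≤x ; loc<x = λ () ; locals = λ () ; heap = h
        ; params = λ { zero → e0 ; (suc zero) → e1 ; (suc (suc zero)) → e2 ; (suc (suc (suc zero))) → e3 } }

    state-write : ∀ {H a v x M M′} → 4 ≤ x → x < 7 → State H a M → Writes x v M M′ → State H a M′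
    state-write {x = x} 4≤x x<7 (e0 , e1 , e2 , e3 , h) (_ , o) =
        trans (o 0 (<⇒≢ (≤-trans (m≤m+n 1 3) 4≤x))) e0
      , trans (o 1 (<⇒≢ (≤-trans (m≤m+n 2 2) 4≤x))) e1
      , trans (o 2 (<⇒≢ (≤-trans (m≤m+n 3 1) 4≤x))) e2
      , trans (o 3 (<⇒≢ 4≤x)) e3
      , λ b → trans (o (R + b) (≢-sym (<⇒≢ (<-≤-trans x<7 (≤-trans 7≤R (m≤m+n R b)))))) (h b)

    state-3 : ∀ {H a v M M′} → State H a M → Writes 3 v M M′ → State H v M′
    state-3 (e0 , e1 , e2 , _ , h) (e , o) =
      trans (o 0 λ ()) e0 , trans (o 1 λ ()) e1 , trans (o 2 λ ()) e2 , e ,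
      λ b → trans (o (R + b) (≢-sym (<⇒≢ (<-≤-trans (m≤m+n 4 3) (≤-trans 7≤R (m≤m+n R b)))))) (h b)

    state-heap : ∀ {H a b v M M′} → State H a M → Writes (R + b) v M M′ → State (H [ b ≔ v ]) a M′
    state-heap {H} {a} {b} {v} {M} {M′} (e0 , e1 , e2 , e3 , h) (e , o) =
        trans (o 0 (low (m≤m+n 1 6))) e0 , trans (o 1 (low (m≤m+n 2 5))) e1
      , trans (o 2 (low (m≤m+n 3 4))) e2 , trans (o 3 (low (m≤m+n 4 3))) e3 , heap
      where
      low : ∀ {x} → x < 7 → x ≢ R + b
      low x<7 = <⇒≢ (<-≤-trans x<7 (≤-trans 7≤R (m≤m+n R b)))
      heap : ∀ c → M′ (R + c) ≡ (H [ b ≔ v ]) c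
      heap c with c ≟ b
      ... | yes refl = trans e (sym (≔-same H b v))
      ... | no  c≢b  = trans (o (R + c) (λ eq → c≢b (+-cancelˡ-≡ R c b eq))) (trans (h c) (sym (≔-other H v c≢b)))

    fill-correct : ∀ Z {M} → Bounded Z → State (heapAt 0) S M → M 4 ≡ L →
                   Exec (fill R) M (fill-time Z) (State (heapAt L) (S + L))
    fill-correct Z {M} b st e4 =
      exec-≤ (s≤s (*-monoˡ-≤ _ (b .Bounded.L≤Z)))
        (exec-map (λ {M′} (e , j , eq , st) → subst (λ j → State (heapAt j) (S + j) M′) (trans (sym (+-identityʳ j)) eq) st)
          (exec-while I proj₁ body L (e4 , 0 , refl , subst (λ a → State (heapAt 0) a M) (sym (+-identityʳ S)) st)))
      where
      I : ℕ → Memory → Set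
      I i M = M 4 ≡ i × ∃[ j ] j + i ≡ L × State (heapAt j) (S + j) M
      body : ∀ {i M} → I (suc i) M →
             Exec (compile R entry [] 5 ⨟ const 6 R ⨟ add 6 6 3 ⨟ store 6 5 ⨟ const 6 1 ⨟ add 3 3 6 ⨟ sub 4 4 6) M
               (time entry Z + 6) (I i)
      body {i} {M} (e4 , j , eq , st) =
        eval entry (m≤m+n 4 1) entry≤ st (b .Bounded.entry-safe j j<L) ⟫ λ (e5 , st₁@(_ , _ , _ , e3 , _) , o) →
        exec-const ⟫ λ w₂@(e₂ , o₂) →
        exec-add {v = R + (S + j)} (cong₂ _+_ e₂ (trans (o₂ 3 λ ()) e3)) ⟫ λ w₃@(e₃ , o₃) →
        exec-store e₃ (trans (o₃ 5 λ ()) (trans (o₂ 5 λ ()) e5)) ⟫ λ w₄@(e₄ , o₄) →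
        exec-const ⟫ λ w₅@(e₅ , o₅) →
        let st₃ = state-write (m≤m+n 4 2) ≤-refl (state-write (m≤m+n 4 2) ≤-refl st₁ w₂) w₃
            st₅ = state-write (m≤m+n 4 2) ≤-refl (state-heap st₃ w₄) w₅
            e3′ = proj₁ (proj₂ (proj₂ (proj₂ st₅)))
        in
        exec-add {v = S + suc j} (trans (cong₂ _+_ e3′ e₅) (trans (+-comm (S + j) 1) (sym (+-suc S j)))) ⟫ λ w₆@(e₆ , o₆) →
        exec-map (λ w₇@(e₇ , o₇) →
            e₇ , suc j , trans (sym (+-suc j i)) eq , state-write ≤-refl (m≤m+n 5 2) (state-3 st₅ w₆) w₇)
          (exec-sub (cong₂ _∸_
            (trans (o₆ 4 λ ()) (trans (o₅ 4 λ ()) (trans (o₄ 4 (<⇒≢ (<-≤-trans (m≤m+n 5 2) (≤-trans 7≤R (m≤m+n R _))))) (trans (o₃ 4 λ ()) (trans (o₂ 4 λ ())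
              (trans (o 4 ≤-refl) e4))))))
            (trans (o₆ 6 λ ()) e₅)))
        where
        j<L : j < L
        j<L = ≤-trans (s≤s (m≤m+n j i)) (≤-reflexive (trans (sym (+-suc j i)) eq))

  program-correct : ∀ Z → Bounded Z →
    Exec program (initial (k ∷ d ∷ n ∷ bits)) (program-time Z)
      (λ M → M 0 ≡ ⟦ answer ⟧ (heapAt L) (params (S + L)) [])
  program-correct Z b =
    exec-map (λ ((e0 , e1 , e2) , h) → e0 , e1 , e2 , refl , h) (relocate-correct Z n≤Z n*n≤Z) ⟫ λ {M₁} st →
    eval start ≤-refl start≤ st (start-safe (M₁ 3)) ⟫ λ (e4 , st₁ , _) →
    exec-const ⟫ λ w₂@(e₂ , o₂) →
    exec-add {v = S} (cong₂ _+_ e₂ (trans (o₂ 4 λ ()) (trans e4 (start-value _)))) ⟫ λ w₃ →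
    eval count ≤-refl count≤ (state-3 (state-3 st₁ w₂) w₃) count-safe ⟫ λ (e4 , st₄ , _) →
    fill-correct Z b st₄ (trans e4 count-value) ⟫ λ st₅ →
    eval answer ≤-refl answer≤ st₅ answer-safe ⟫ λ (e4 , _) →
    exec-const ⟫ λ (e₇ , o₇) →
    exec-map proj₁ (exec-add (cong₂ _+_ e₇ (trans (o₇ 4 λ ()) e4)))
    where
    open Bounded b
    open Relocation R 7≤R k d n bits boolean len

-- The program

kᴱ dᴱ nᴱ aᴱ : ∀ {m} → Expr m
kᴱ = par zero
dᴱ = par (suc zero)
nᴱ = par (suc (suc zero))
aᴱ = par (suc (suc (suc zero)))

v₀ : ∀ {m} → Expr (suc m)
v₀ = var zero
v₁ : ∀ {m} → Expr (suc (suc m))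
v₁ = var (suc zero)
v₂ : ∀ {m} → Expr (suc (suc (suc m)))
v₂ = var (suc (suc zero))
v₃ : ∀ {m} → Expr (suc (suc (suc (suc m))))
v₃ = var (suc (suc (suc zero)))

addrᴱ : ∀ {m} → Expr m → Expr m → Expr m → Expr m
addrᴱ t x y = (t ⊗ nᴱ ⊕ x) ⊗ nᴱ ⊕ y

-- Heap layout: the adjacency matrix is at addr 0 x y, the relation "distance at most t"
-- at addr (t + 1) x y for t ≤ d, and (k + 2) ^ j at base + u if j of the first u
-- vertices are selected.
baseᴱ : ∀ {m} → Expr m
baseᴱ = (lit 2 ⊕ dᴱ) ⊗ nᴱ ⊗ nᴱ

power power⁺ : ∀ {m} → Expr m → Expr m
power u  = get (baseᴱ ⊕ u)
power⁺ u = get (baseᴱ ⊕ (lit 1 ⊕ u))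

-- There is no division, so the coordinates t, x, y of the address are found by search. As "distance
-- at most t" is stored at level t + 1, the lookup `addrᴱ v₃ v₀ v₁` reads the relation for t - 1.
-- For t = 0 it would read the adjacency matrix, which `lit 0 ≺ v₂` prevents.
layer : Formula 0
layer =
  ∃ᶠ (lit 1 ⊕ dᴱ) (∃ᶠ nᴱ (∃ᶠ nᴱ
    ( aᴱ ≐ addrᴱ (lit 1 ⊕ v₂) v₁ v₀
    ∧ᶠ ( v₁ ≐ v₀
       ∨ᶠ ( lit 0 ≺ v₂
          ∧ᶠ ∃ᶠ nᴱ (lit 0 ≺ get (addrᴱ (lit 0) v₂ v₀) ∧ᶠ lit 0 ≺ get (addrᴱ v₃ v₀ v₁)))))))

-- The range tests make an absent centre near to nothing, and they bound the loops of the address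
-- computation that follows.
near : ∀ {m} → Fin m → Fin m → Formula m
near u x = var u ≺ nᴱ ∧ᶠ var x ≺ nᴱ ∧ᶠ lit 0 ≺ get (addrᴱ (lit 1 ⊕ dᴱ) (var u) (var x))

-- The base k + 2 is at least 2 even for k = 0, so a selection always shows as a strict increase.
selected : ∀ {m} → Fin m → Formula m
selected u = power (var u) ≺ power⁺ (var u)

-- The code c, read in base k + 2, has the digit i at the position of u.
digit : ∀ {m} → Fin m → Fin m → Fin m → Formula m
digit u c i =
  ∃ᶠ (lit 1 ⊕ var c) (∃ᶠ (power (var (suc u)))
    (var (suc (suc c)) ≐ v₁ ⊗ power⁺ (var (suc (suc u))) ⊕ var (suc (suc i)) ⊗ power (var (suc (suc u))) ⊕ v₀))

-- Some k centres hit all vertices selected before v and miss v.  The code c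
-- distributes the selected vertices over the centres, and a centre may be absent (x = n).
separable : ∀ {m} → Fin m → Formula m
separable v =
  ∃ᶠ (power (var v))
    ( ∀ᶠ (var (suc v)) (selected zero ⇒ ∃ᶠ kᴱ (digit (suc zero) (suc (suc zero)) zero))
    ∧ᶠ ∀ᶠ kᴱ (∃ᶠ (lit 1 ⊕ nᴱ)
         ( ¬ᶠ near (suc (suc (suc v))) zero
         ∧ᶠ ∀ᶠ (var (suc (suc (suc v))))
              (selected zero ∧ᶠ digit zero (suc (suc (suc zero))) (suc (suc zero)) ⇒ near zero (suc zero)))))

-- The three summands serve disjoint ranges of addresses: the distance relations, the initial power
-- 1, and the later powers. The `sum` acts as a search for the vertex `v` whose power is due, and
-- its factor is 1 or k + 2 according to the test. The guard confines `separable` to the cell where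
-- all powers that it reads are already present.
entryᴱ : Expr 0
entryᴱ =
  guard (indicator (aᴱ ≺ baseᴱ)) (indicator layer) ⊕
  indicator (aᴱ ≐ baseᴱ) ⊕
  sum nᴱ (guard (indicator (aᴱ ≐ baseᴱ ⊕ (lit 1 ⊕ v₀)))
                ((lit 1 ⊕ guard (indicator (separable zero)) (lit 1 ⊕ kᴱ)) ⊗ power v₀))

-- At the position n there is no vertex to be missed, so `separable` only asks for k centres that
-- hit everything selected. The double subtraction turns a positive count into 1.
answerᴱ : Expr 0
answerᴱ = lit 1 ⊖ (lit 1 ⊖ indicator (∃ᶠ (lit 1 ⊕ nᴱ) (v₀ ≐ nᴱ ∧ᶠ separable zero)))

dominationTable : Tabulation
dominationTable = record
  { start  = nᴱ ⊗ nᴱ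
  ; count  = (lit 1 ⊕ dᴱ) ⊗ nᴱ ⊗ nᴱ ⊕ (lit 1 ⊕ nᴱ)
  ; entry  = entryᴱ
  ; answer = answerᴱ
  }

-- Distances

module _ {G : Graph} (K : Subgraph G) where
  open Subgraph K using (edge; endpoint)

  -- Walks of bounded length take the place of shortest paths: they compose at once, and their
  -- constructors are the recurrence of the table.
  data Near : ℕ → Vertex G → Vertex G → Set where
    stay : ∀ {t v} → v ∈ verts K → Near t v v
    move : ∀ {t u w v} → T (edge u w) → Near t w v → Near (suc t) u v

  near? : ∀ t u v → Dec (Near t u v)
  near? zero u v with u ≟ᶠ v | u ∈? verts K
  ... | yes refl | yes u∈K = yes (stay u∈K)
  ... | yes refl | no u∉K  = no λ { (stay u∈K) → u∉K u∈K }
  ... | no u≢v   | _       = no λ { (stay _) → u≢v refl }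
  near? (suc t) u v with any? (λ w → T? (edge u w) ×-dec near? t w v)
  ... | yes (w , e , p) = yes (move e p)
  ... | no ¬p with u ≟ᶠ v | u ∈? verts K
  ...   | yes refl | yes u∈K = yes (stay u∈K)
  ...   | yes refl | no u∉K  = no λ { (stay u∈K) → u∉K u∈K ; (move e p) → ¬p (_ , e , p) }
  ...   | no u≢v   | _       = no λ { (stay _) → u≢v refl ; (move e p) → ¬p (_ , e , p) }

  near-start : ∀ {t u v} → Near t u v → u ∈ verts K
  near-start (stay u∈K) = u∈K
  near-start (move e _) = endpoint e

  near-mono : ∀ {s t u v} → s ≤ t → Near s u v → Near t u v
  near-mono _         (stay v∈K) = stay v∈K
  near-mono (s≤s s≤t) (move e p) = move e (near-mono s≤t p)

  near-trans : ∀ {s t u w v} → Near s u w → Near t w v → Near (s + t) u v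
  near-trans {s} {t} (stay _) q = near-mono (m≤n+m t s) q
  near-trans (move e p) q = move e (near-trans p q)

  walk⇒near : ∀ {u v vs t} → Walk K u v vs → length vs ≤ suc t → Near t u v
  walk⇒near (here v∈K) _ = stay v∈K
  walk⇒near {t = zero}  (step e (here _))   (s≤s ())
  walk⇒near {t = zero}  (step e (step _ _)) (s≤s ())
  walk⇒near {t = suc t} (step e w)          (s≤s l) = move e (walk⇒near w l)

  -- This cuts off the cycle that would arise if a step from `u` were put in front of a path already
  -- visiting `u`.
  walk-from : ∀ {u w v vs} → Walk K w v vs → Unique vs → u ∈ᴸ vs →
              ∃[ us ] Walk K u v us × Unique us × length us ≤ length vs
  walk-from w@(here _)   us       (here refl) = _ , w , us , ≤-refl
  walk-from w@(step _ _) us       (here refl) = _ , w , us , ≤-refl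
  walk-from (step _ w)   (_ ∷ us) (there u∈) with walk-from w us u∈
  ... | us′ , w′ , un , l = us′ , w′ , un , m≤n⇒m≤1+n l

  near⇒path : ∀ {t u v} → Near t u v → ∃[ vs ] Walk K u v vs × Unique vs × length vs ≤ suc t
  near⇒path (stay v∈K) = _ , here v∈K , [] ∷ [] , s≤s z≤n
  near⇒path {u = u} (move e p) with near⇒path p
  ... | vs , w , un , l with anyᴸ? (u ≟ᶠ_) vs
  ...   | no  u∉ = u ∷ vs , step e w , ¬Any⇒All¬ vs u∉ ∷ un , s≤s l
  ...   | yes u∈ with walk-from w un u∈
  ...     | us , w′ , un′ , l′ = us , w′ , un′ , m≤n⇒m≤1+n (≤-trans l′ l)

  walk-nonempty : ∀ {u v vs} → Walk K u v vs → ∃[ ℓ ] length vs ≡ suc ℓ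
  walk-nonempty (here _)   = _ , refl
  walk-nonempty (step _ _) = _ , refl

  -- Descending to the least radius at which `Near` holds gives a path that cannot be shortened,
  -- since a shorter one would witness the next smaller radius.
  near⇒distance : ∀ t {u v} → Near t u v → ∃[ ℓ ] Distance K u v ℓ × ℓ ≤ t
  near⇒distance t {u} {v} p with near⇒path p
  near⇒distance zero p | vs , w , un , l with walk-nonempty w
  ... | ℓ , eq = ℓ , ((vs , w , un , eq) , λ _ → ≤-trans ℓ≤0 z≤n) , ℓ≤0
    where ℓ≤0 = ≤-pred (≤-trans (≤-reflexive (sym eq)) l)
  near⇒distance (suc t) {u} {v} p | vs , w , un , l with near? t u v
  ... | yes q = let (ℓ , dist , ℓ≤t) = near⇒distance t q in ℓ , dist , m≤n⇒m≤1+n ℓ≤t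
  ... | no ¬q with walk-nonempty w
  ...   | ℓ , eq = ℓ , ((vs , w , un , eq) , shortest) , ℓ≤1+t
    where
    ℓ≤1+t = ≤-pred (≤-trans (≤-reflexive (sym eq)) l)
    shortest : ∀ {ℓ′} → Path K u v ℓ′ → ℓ ≤ ℓ′
    shortest {ℓ′} (_ , w′ , _ , eq′) with ℓ′ ≤? t
    ... | yes ℓ′≤t = ⊥-elim (¬q (walk⇒near w′ (≤-trans (≤-reflexive eq′) (s≤s ℓ′≤t))))
    ... | no  ℓ′≰t = ≤-trans ℓ≤1+t (≰⇒> ℓ′≰t)

  near⇒distance≤ : ∀ {r t u v} → t ≤ r → Near t u v → DistanceAtMost K r u v
  near⇒distance≤ t≤r p with near⇒distance _ p
  ... | ℓ , dist , ℓ≤t = ℓ , dist , ≤-trans ℓ≤t t≤r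

  distance≤⇒near : ∀ {r u v} → DistanceAtMost K r u v → Near r u v
  distance≤⇒near (ℓ , ((vs , w , _ , eq) , _) , ℓ≤r) = walk⇒near w (≤-trans (≤-reflexive eq) (s≤s ℓ≤r))

  -- The minimum of the distance and d + 1. It takes d + 2 values, with unreachable vertices
  -- included, which makes distance profiles countable.
  cappedDistance : ℕ → Vertex G → Vertex G → ℕ
  cappedDistance zero u v with near? zero u v
  ... | yes _ = 0
  ... | no  _ = 1
  cappedDistance (suc d) u v with near? d u v | near? (suc d) u v
  ... | yes _ | _     = cappedDistance d u v
  ... | no  _ | yes _ = suc d
  ... | no  _ | no  _ = suc (suc d)

  cappedDistance-near : ∀ d {t u v} → t ≤ d → Near t u v → Near (cappedDistance d u v) u v × cappedDistance d u v ≤ t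
  cappedDistance-near zero {u = u} {v} z≤n p with near? zero u v
  ... | yes q = q , z≤n
  ... | no ¬q = ⊥-elim (¬q p)
  cappedDistance-near (suc d) {t} {u} {v} t≤ p with near? d u v | near? (suc d) u v
  ... | yes q | _ with t ≤? d
  ...   | yes t≤d = cappedDistance-near d t≤d p
  ...   | no  t≰d = let (r , l) = cappedDistance-near d ≤-refl q in r , ≤-trans l (<⇒≤ (≰⇒> t≰d))
  cappedDistance-near (suc d) {t} t≤ p | no ¬q | yes q with t ≤? d
  ...   | yes t≤d = ⊥-elim (¬q (near-mono t≤d p))
  ...   | no  t≰d = q , ≰⇒> t≰d
  cappedDistance-near (suc d) t≤ p | no _ | no ¬q = ⊥-elim (¬q (near-mono t≤ p))

  near-cappedDistance : ∀ d {u v} → cappedDistance d u v ≤ d → Near (cappedDistance d u v) u v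
  near-cappedDistance zero {u} {v} c≤ with near? zero u v
  ... | yes p = p
  near-cappedDistance zero () | no _
  near-cappedDistance (suc d) {u} {v} c≤ with near? d u v | near? (suc d) u v
  ... | yes p | _     = proj₁ (cappedDistance-near d ≤-refl p)
  ... | no  _ | yes p = p
  ... | no  _ | no  _ = ⊥-elim (1+n≰n c≤)

  cappedDistance< : ∀ d u v → cappedDistance d u v < 2 + d
  cappedDistance< zero u v with near? zero u v
  ... | yes _ = s≤s z≤n
  ... | no  _ = s≤s (s≤s z≤n)
  cappedDistance< (suc d) u v with near? d u v | near? (suc d) u v
  ... | yes _ | _     = m≤n⇒m≤1+n (cappedDistance< d u v)
  ... | no  _ | yes _ = n≤1+n _
  ... | no  _ | no  _ = ≤-refl

-- The walk is cut at its first vertex in `S`; if there is none, all its edges survive in `G -ᴳ S`.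
near-separator : ∀ {G : Graph} (S : Subset (order G)) {t u x} → Near (whole G) t u x →
  Near (G -ᴳ S) t u x ⊎
  ∃[ s ] s ∈ S × (∃[ t₁ ] ∃[ t₂ ] t₁ + t₂ ≤ t × Near (whole G) t₁ u s × Near (whole G) t₂ s x)
near-separator S {u = u} p with u ∈? S
near-separator S {t} {u} p | yes u∈S = inj₂ (u , u∈S , 0 , t , ≤-refl , stay ∈⊤ , p)
near-separator S (stay _) | no u∉S = inj₁ (stay (x∉p⇒x∈∁p u∉S))
near-separator {G} S {u = u} (move {w = w} e p) | no u∉S with near-separator S p
... | inj₂ (s , s∈S , t₁ , t₂ , l , q₁ , q₂) = inj₂ (s , s∈S , suc t₁ , t₂ , s≤s l , move e q₁ , q₂)
... | inj₁ q = inj₁ (move (from (T-∧ {Graph.adj G u w}) (e , from T-∧ (kept (x∉p⇒x∈∁p u∉S) , kept (near-start (G -ᴳ S) q)))) q)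
  where
  kept : ∀ {y} → y ∈ ∁ S → T (lookup (∁ S) y)
  kept y∈ = from T-≡ ([]=⇒lookup y∈)

-- Ladders have bounded length

∣p∪q∣≤∣p∣+∣q∣ : ∀ {n} (p q : Subset n) → ∣ p ∪ q ∣ ≤ ∣ p ∣ + ∣ q ∣
∣p∪q∣≤∣p∣+∣q∣ []            []            = z≤n
∣p∪q∣≤∣p∣+∣q∣ (outside ∷ p) (outside ∷ q) = ∣p∪q∣≤∣p∣+∣q∣ p q
∣p∪q∣≤∣p∣+∣q∣ (outside ∷ p) (inside ∷ q)  =
  ≤-trans (s≤s (∣p∪q∣≤∣p∣+∣q∣ p q)) (≤-reflexive (sym (+-suc ∣ p ∣ ∣ q ∣)))
∣p∪q∣≤∣p∣+∣q∣ (inside ∷ p)  (outside ∷ q) = s≤s (∣p∪q∣≤∣p∣+∣q∣ p q)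
∣p∪q∣≤∣p∣+∣q∣ (inside ∷ p)  (inside ∷ q)  =
  s≤s (≤-trans (∣p∪q∣≤∣p∣+∣q∣ p q) (+-monoʳ-≤ ∣ p ∣ (n≤1+n ∣ q ∣)))

fromList : ∀ {n} → List (Fin n) → Subset n
fromList []       = ⊥
fromList (x ∷ xs) = ⁅ x ⁆ ∪ fromList xs

∈-fromList⁺ : ∀ {n} {x : Fin n} {xs} → x ∈ᴸ xs → x ∈ fromList xs
∈-fromList⁺ {x = x} (here refl) = x∈p∪q⁺ (inj₁ (x∈⁅x⁆ x))
∈-fromList⁺         (there x∈)  = x∈p∪q⁺ (inj₂ (∈-fromList⁺ x∈))

∈-fromList⁻ : ∀ {n} {x : Fin n} xs → x ∈ fromList xs → x ∈ᴸ xs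
∈-fromList⁻ []       x∈ = ⊥-elim (∉⊥ x∈)
∈-fromList⁻ (y ∷ ys) x∈ with x∈p∪q⁻ ⁅ y ⁆ (fromList ys) x∈
... | inj₁ x∈y  = here (x∈⁅y⁆⇒x≡y y x∈y)
... | inj₂ x∈ys = there (∈-fromList⁻ ys x∈ys)

∣fromList∣≤length : ∀ {n} (xs : List (Fin n)) → ∣ fromList xs ∣ ≤ length xs
∣fromList∣≤length {n} [] = ≤-reflexive (∣⊥∣≡0 n)
∣fromList∣≤length (x ∷ xs) =
  ≤-trans (∣p∪q∣≤∣p∣+∣q∣ ⁅ x ⁆ (fromList xs)) (+-mono-≤ (≤-reflexive (∣⁅x⁆∣≡1 x)) (∣fromList∣≤length xs))

length≤∣fromList∣ : ∀ {n} {xs : List (Fin n)} → Unique xs → length xs ≤ ∣ fromList xs ∣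
length≤∣fromList∣ [] = z≤n
length≤∣fromList∣ {xs = x ∷ xs} (x∉ ∷ u) = ≤-<-trans (length≤∣fromList∣ u)
  (p⊂q⇒∣p∣<∣q∣ ( q⊆p∪q ⁅ x ⁆ (fromList xs) , x , x∈p∪q⁺ (inj₁ (x∈⁅x⁆ x))
               , λ x∈ → All.lookup x∉ (∈-fromList⁻ xs x∈) refl))

elements : ∀ {n} (p : Subset n) → ∃[ xs ] length xs ≡ ∣ p ∣ × (∀ {x} → x ∈ p → x ∈ᴸ xs)
elements [] = [] , refl , λ ()
elements (outside ∷ p) with elements p
... | xs , eq , f = map suc xs , trans (length-map suc xs) eq , λ { (there x∈) → ∈-map⁺ suc (f x∈) }
elements (inside ∷ p) with elements p
... | xs , eq , f = zero ∷ map suc xs , cong suc (trans (length-map suc xs) eq) ,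
  λ { here → here refl ; (there x∈) → there (∈-map⁺ suc (f x∈)) }

module _ {A : Set} (f : A → ℕ) where

  length-split : ∀ c xs → All (λ a → f a < suc c) xs →
    ∃[ ys ] ∃[ zs ] ys ⊑ xs × zs ⊑ xs × All (λ a → f a ≡ c) ys × All (λ a → f a < c) zs ×
    length xs ≡ length ys + length zs
  length-split c [] [] = [] , [] , [] , [] , [] , [] , refl
  length-split c (x ∷ xs) (fx< ∷ fxs<) with length-split c xs fxs< | f x ≟ c
  ... | ys , zs , p , q , py , pz , eq | yes e =
    x ∷ ys , zs , refl ∷ p , x ∷ʳ q , e ∷ py , pz , cong suc eq
  ... | ys , zs , p , q , py , pz , eq | no ne =
    ys , x ∷ zs , x ∷ʳ p , refl ∷ q , py , ≤∧≢⇒< (≤-pred fx<) ne ∷ pz ,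
    trans (cong suc eq) (sym (+-suc (length ys) (length zs)))

  -- Pigeonhole from the top value down: if the fibre of the largest value has at most `q` elements,
  -- discarding it loses at most `q` of the list and one of the values.
  large-fibre : ∀ c q xs → All (λ a → f a < c) xs → c * q < length xs →
                ∃[ i ] ∃[ ys ] ys ⊑ xs × q < length ys × All (λ a → f a ≡ i) ys
  large-fibre zero    q []       _         ()
  large-fibre zero    q (x ∷ xs) (() ∷ _) _
  large-fibre (suc c) q xs small long with length-split c xs small
  ... | ys , zs , ys⊑ , zs⊑ , py , pz , eq with q <? length ys
  ...   | yes q< = c , ys , ys⊑ , q< , py
  ...   | no  q≮ with large-fibre c q zs pz (+-cancelˡ-< q (c * q) (length zs)
                        (<-≤-trans long (≤-trans (≤-reflexive eq) (+-monoˡ-≤ (length zs) (≮⇒≥ q≮)))))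
  ...     | i , ws , ws⊑ , q< , pw = i , ws , ⊆-trans ws⊑ zs⊑ , q< , pw

-- Every `b` costs one factor `c`. The result is a sublist and not merely a subset, because a ladder
-- depends on the order of its vertices.
large-common-fibre : ∀ {A B : Set} (f : A → B → ℕ) {c} → (∀ a b → f a b < c) → ∀ q (bs : List B) xs →
  c ^ length bs * q < length xs →
  ∃[ ys ] ys ⊑ xs × q < length ys × All (λ b → ∃[ i ] All (λ a → f a b ≡ i) ys) bs
large-common-fibre f small q [] xs long = xs , ⊆-refl , subst (_< length xs) (+-identityʳ q) long , []
large-common-fibre f {c} small q (b ∷ bs) xs long
  with large-fibre (λ a → f a b) c (c ^ length bs * q) xs (All.tabulate (λ {a} _ → small a b))
         (subst (_< length xs) (*-assoc c (c ^ length bs) q) long)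
... | i , ys , ys⊑ , long′ , py with large-common-fibre f small q bs ys long′
...   | zs , zs⊑ , q< , pz = zs , ⊆-trans zs⊑ ys⊑ , q< , (i , All-resp-⊆ zs⊑ py) ∷ pz

module _ (G : Graph) (k d : ℕ) where

  Hit : Vertex G → ℕ → Set
  Hit u x = ∃[ y ] toℕ y ≡ x × Near (whole G) d u y

  -- Centres are natural numbers, those ≥ order G being absent.
  Hits : (Fin k → ℕ) → Vertex G → Set
  Hits X u = ∃[ i ] Hit u (X i)

  -- A semi-ladder between vertices and k-tuples of centres: each vertex is missed by a tuple that
  -- hits all vertices added before it. The head is the vertex added last.
  data Ladder : List (Vertex G) → Set where
    []   : Ladder []
    rung : ∀ {w W X} → ¬ Hits X w → All (Hits X) W → Ladder W → Ladder (w ∷ W)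

  ladder-⊑ : ∀ {W W′} → W′ ⊑ W → Ladder W → Ladder W′
  ladder-⊑ []         []           = []
  ladder-⊑ (_ ∷ʳ s)   (rung m h l) = ladder-⊑ s l
  ladder-⊑ (refl ∷ s) (rung m h l) = rung m (All-resp-⊆ s h) (ladder-⊑ s l)

  ladder-unique : ∀ {W} → Ladder W → Unique W
  ladder-unique [] = []
  ladder-unique (rung m h l) = All.map (λ { hit refl → m hit }) h ∷ ladder-unique l

unique-lookup : ∀ {A : Set} {xs : List A} → Unique xs → ∀ {i j} → List.lookup xs i ≡ List.lookup xs j → i ≡ j
unique-lookup (_ ∷ u)  {zero}  {zero}  _  = refl
unique-lookup (x∉ ∷ u) {zero}  {suc j} eq = ⊥-elim (All.lookup x∉ (∈-lookup j) eq)
unique-lookup (x∉ ∷ u) {suc i} {zero}  eq = ⊥-elim (All.lookup x∉ (∈-lookup i) (sym eq))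
unique-lookup (_ ∷ u)  {suc i} {suc j} eq = cong suc (unique-lookup u eq)

-- As t₁ is at most d, the cap is not reached. Hence `w` is as close to `s` as `u` is, and the part
-- of the path behind `s` can be kept.
reroute : ∀ {G : Graph} {d t₁ t₂ u w s x} →
  cappedDistance (whole G) d w s ≡ cappedDistance (whole G) d u s → t₁ + t₂ ≤ d →
  Near (whole G) t₁ u s → Near (whole G) t₂ s x → Near (whole G) d w x
reroute {G} {d} {t₁} same t≤d q r =
  near-mono _ t≤d (near-trans _ (near-mono _ w≤t₁ (near-cappedDistance _ d (≤-trans w≤t₁ t₁≤d))) r)
  where
  t₁≤d = ≤-trans (m≤m+n t₁ _) t≤d
  w≤t₁ = ≤-trans (≤-reflexive same) (proj₂ (cappedDistance-near (whole G) d t₁≤d q))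

-- Two of the vertices of W share a centre x of X.  Their short paths to x cannot both
-- avoid S, and a path through S can be rerouted to start at w, which X misses.
scattered-ladder-short : ∀ {G k d p} (S A : Subset (order G)) → d ≤ p → Scattered (G -ᴳ S) p A →
  ∀ {w W} → Ladder G k d (w ∷ W) → All (_∈ A) W →
  (∀ {s} → s ∈ S → ∃[ i ] All (λ a → cappedDistance (whole G) d a s ≡ i) (w ∷ W)) →
  ¬ k < length W
scattered-ladder-short {G} {k} {d} S A d≤p scattered {w} {W} (rung {X = X} misses hits l) W⊆A common k<
  with pigeonhole k< (λ j → proj₁ (All.lookup hits (∈-lookup j)))
... | i , j , i<j , same
  with All.lookup hits (∈-lookup {xs = W} i) | All.lookup hits (∈-lookup {xs = W} j)
... | c , x , x≡ , nᵢ | c′ , x′ , x′≡ , nⱼ with same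
... | refl with toℕ-injective (trans x≡ (sym x′≡))
... | refl with near-separator S nᵢ | near-separator S nⱼ
... | inj₁ pᵢ | inj₁ pⱼ =
  proj₂ scattered (All.lookup W⊆A (∈-lookup i)) (All.lookup W⊆A (∈-lookup j))
    (λ eq → <ᶠ⇒≢ i<j (unique-lookup (ladder-unique G k d l) eq)) x
    (near⇒distance≤ _ d≤p pᵢ , near⇒distance≤ _ d≤p pⱼ)
... | inj₂ (s , s∈S , _ , _ , t≤d , q , r) | _ with common s∈S
...   | _ , ew ∷ eW = misses (c , x , x≡ , reroute (trans ew (sym (All.lookup eW (∈-lookup i)))) t≤d q r)
scattered-ladder-short S A d≤p scattered {w} {W} (rung misses hits l) W⊆A common k<
  | i , j , i<j , same | c , x , x≡ , nᵢ | c′ , x′ , x′≡ , nⱼ | refl | refl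
  | inj₁ _ | inj₂ (s , s∈S , _ , _ , t≤d , q , r) with common s∈S
...   | _ , ew ∷ eW = misses (c , x , x≡ , reroute (trans ew (sym (All.lookup eW (∈-lookup j)))) t≤d q r)

-- Fewer than `s p` separating vertices with at most p + 2 capped distances each leave at most
-- `(2 + p) ^ s p` profiles. One more than p + 1 vertices per profile force k + 2 vertices of the
-- same profile.
scatteredSize : (ℕ → ℕ) → ℕ → ℕ
scatteredSize s p = suc ((2 + p) ^ s p * suc p)

-- Neither `s` nor `N` is assumed monotone, so bounds taken at d and k could not be compared with
-- one at `p`. Quasi-wideness is therefore applied at radius `p` itself; scatteredness for `p` also
-- separates balls of radius d.
ladder-bound : ∀ {C s N} → UniformlyQuasiWide C s N → ∀ {G k d p} → C G → k ≤ p → d ≤ p →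
  ∀ {W} → Ladder G k d W → length W ≤ N p (scatteredSize s p)
ladder-bound {s = s} {N} uqw {G} {k} {d} {p} G∈C k≤p d≤p {W} l = ≮⇒≥ short
  where
  short : ¬ N p (scatteredSize s p) < length W
  short long
    with uqw p (scatteredSize s p) G∈C (fromList W) (<-≤-trans long (length≤∣fromList∣ (ladder-unique G k d l)))
  ... | S , S< , A , A⊆W , A≥ , scattered with elements S
  ... | Ss , Ss-length , S⊆Ss
    -- Quasi-wideness returns an unordered set `A`. Filtering `W` by it recovers the order and makes
    -- the result a ladder again.
    with large-common-fibre (cappedDistance (whole G) d) (cappedDistance< (whole G) d) (suc k) Ss
           (filter (_∈? A) W)
           (≤-trans (s≤s (*-mono-≤ pow≤ (s≤s k≤p))) (≤-trans A≥ (≤-trans (p⊆q⇒∣p∣≤∣q∣ A⊆) (∣fromList∣≤length (filter (_∈? A) W)))))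
    where
    pow≤ : (2 + d) ^ length Ss ≤ (2 + p) ^ s p
    pow≤ = ≤-trans (^-monoˡ-≤ (length Ss) (s≤s (s≤s d≤p)))
             (^-monoʳ-≤ (2 + p) (≤-trans (≤-reflexive Ss-length) (<⇒≤ S<)))
    A⊆ : A ⊆ fromList (filter (_∈? A) W)
    A⊆ a∈A = ∈-fromList⁺ (∈-filter⁺ (_∈? A) (∈-fromList⁻ W (A⊆W a∈A)) a∈A)
  ... | w ∷ W′ , W′⊑ , s≤s k< , common =
    scattered-ladder-short S A d≤p scattered (ladder-⊑ G k d (⊆-trans W′⊑ (filter-⊆ (_∈? A) W)) l)
      (All.tail (All-resp-⊆ W′⊑ (all-filter (_∈? A) W))) (λ s∈S → All.lookup common (S⊆Ss s∈S)) k<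

-- Contents of the table: adjacency and distances

initial-++ˡ : ∀ xs ys {a} → a < length xs → initial (xs ++ ys) a ≡ initial xs a
initial-++ˡ (x ∷ xs) ys {zero}  _       = refl
initial-++ˡ (x ∷ xs) ys {suc a} (s≤s l) = initial-++ˡ xs ys l

initial-++ʳ : ∀ xs ys a → initial (xs ++ ys) (length xs + a) ≡ initial ys a
initial-++ʳ []       ys a = refl
initial-++ʳ (x ∷ xs) ys a = initial-++ʳ xs ys a

initial-tabulate : ∀ {n} (f : Fin n → ℕ) i → initial (tabulate f) (toℕ i) ≡ f i
initial-tabulate f zero    = refl
initial-tabulate f (suc i) = initial-tabulate (f ∘ suc) i

initial-map≤ : ∀ {A : Set} (f : A → ℕ) {b} → (∀ x → f x ≤ b) → ∀ xs a → initial (map f xs) a ≤ b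
initial-map≤ f f≤ []       a       = z≤n
initial-map≤ f f≤ (x ∷ xs) zero    = f≤ x
initial-map≤ f f≤ (x ∷ xs) (suc a) = initial-map≤ f f≤ xs a

module _ {A : Set} {n : ℕ} (f : A × Fin n → ℕ) where

  length-row-product : ∀ xs → length (map f (cartesianProduct xs (allFin n))) ≡ length xs * n
  length-row-product [] = refl
  length-row-product (x ∷ xs) = begin
    length (map f (map (x ,_) (allFin n) ++ cartesianProduct xs (allFin n)))
      ≡⟨ cong length (map-++ f (map (x ,_) (allFin n)) _) ⟩
    length (map f (map (x ,_) (allFin n)) ++ map f (cartesianProduct xs (allFin n)))
      ≡⟨ length-++ (map f (map (x ,_) (allFin n))) ⟩
    length (map f (map (x ,_) (allFin n))) + length (map f (cartesianProduct xs (allFin n)))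
      ≡⟨ cong₂ _+_ (trans (length-map f (map (x ,_) (allFin n))) (trans (length-map (x ,_) (allFin n)) (length-tabulate id)))
                   (length-row-product xs) ⟩
    n + length xs * n ∎
    where open ≡-Reasoning

  -- Arbitrary row labels `g` are allowed because the induction removes the first row and continues
  -- with `g ∘ suc`.
  initial-row-product : ∀ {m} (g : Fin m → A) i j →
    initial (map f (cartesianProduct (tabulate g) (allFin n))) (toℕ i * n + toℕ j) ≡ f (g i , j)
  initial-row-product {suc m} g i j =
    trans (cong (λ xs → initial xs (toℕ i * n + toℕ j)) split) (go i)
    where
    row : List ℕ
    row = tabulate (λ j → f (g zero , j))
    rest : List ℕ
    rest = map f (cartesianProduct (tabulate (g ∘ suc)) (allFin n))
    row-length : length row ≡ n
    row-length = length-tabulate (λ j → f (g zero , j))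
    split : map f (cartesianProduct (tabulate g) (allFin n)) ≡ row ++ rest
    split = trans (map-++ f (map (g zero ,_) (allFin n)) _)
              (cong (_++ rest) (trans (sym (map-∘ (allFin n))) (map-tabulate id _)))
    go : ∀ i → initial (row ++ rest) (toℕ i * n + toℕ j) ≡ f (g i , j)
    go zero = trans (initial-++ˡ row rest (≤-trans (toℕ<n j) (≤-reflexive (sym row-length)))) (initial-tabulate _ j)
    go (suc i) = begin
      initial (row ++ rest) (n + toℕ i * n + toℕ j)   ≡⟨ cong (initial (row ++ rest)) (+-assoc n _ _) ⟩
      initial (row ++ rest) (n + (toℕ i * n + toℕ j)) ≡⟨ cong (λ l → initial (row ++ rest) (l + (toℕ i * n + toℕ j))) row-length ⟨
      initial (row ++ rest) (length row + (toℕ i * n + toℕ j)) ≡⟨ initial-++ʳ row rest _ ⟩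
      initial rest (toℕ i * n + toℕ j)                ≡⟨ initial-row-product (g ∘ suc) i j ⟩
      f (g (suc i) , j) ∎
      where open ≡-Reasoning

divmod-unique : ∀ {n q q′ r r′} → r < n → r′ < n → q * n + r ≡ q′ * n + r′ → q ≡ q′ × r ≡ r′
divmod-unique {q = zero}  {zero}   _  _   eq = refl , eq
divmod-unique {n} {zero}  {suc q′} r< _   eq = ⊥-elim (<⇒≢ (<-≤-trans r< (≤-trans (m≤m+n n (q′ * n)) (m≤m+n _ _))) eq)
divmod-unique {n} {suc q} {zero}   _  r′< eq = ⊥-elim (<⇒≢ (<-≤-trans r′< (≤-trans (m≤m+n n (q * n)) (m≤m+n _ _))) (sym eq))
divmod-unique {n} {suc q} {suc q′} {r} {r′} r< r′< eq
  with divmod-unique {q = q} {q′} r< r′< (+-cancelˡ-≡ n _ _ (trans (sym (+-assoc n (q * n) r)) (trans eq (+-assoc n (q′ * n) r′))))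
... | refl , refl = refl , refl

addr : ℕ → ℕ → ℕ → ℕ → ℕ
addr n t x y = (t * n + x) * n + y

addr-injective : ∀ {n t x y t′ x′ y′} → x < n → y < n → x′ < n → y′ < n →
                 addr n t x y ≡ addr n t′ x′ y′ → t ≡ t′ × x ≡ x′ × y ≡ y′
addr-injective {n} {t} {x} {y} {t′} {x′} x< y< x′< y′< eq
  with divmod-unique {q = t * n + x} {t′ * n + x′} y< y′< eq
... | e , refl with divmod-unique {q = t} {t′} x< x′< e
...   | refl , refl = refl , refl , refl

m*n+r<[1+m]*n : ∀ m {n r} → r < n → m * n + r < suc m * n
m*n+r<[1+m]*n m {n} r< = <-≤-trans (+-monoʳ-< (m * n) r<) (≤-reflexive (+-comm (m * n) n))

addr< : ∀ {n t t′ x y} → t < t′ → x < n → y < n → addr n t x y < t′ * n * n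
addr< {n} {t} {t′} {x} t< x< y< = <-≤-trans (m*n+r<[1+m]*n (t * n + x) y<)
  (*-monoˡ-≤ n (≤-trans (m*n+r<[1+m]*n t x<) (*-monoˡ-≤ n t<)))

sumTo-zero : ∀ n {f} → (∀ i → i < n → f i ≡ 0) → sumTo n f ≡ 0
sumTo-zero zero    _ = refl
sumTo-zero (suc n) h = cong₂ _+_ (h n ≤-refl) (sumTo-zero n (λ i i< → h i (m≤n⇒m≤1+n i<)))

sumTo-single : ∀ n {f} v → v < n → (∀ i → i < n → i ≢ v → f i ≡ 0) → sumTo n f ≡ f v
sumTo-single (suc n) {f} v v<1+n h with v ≟ n
... | yes refl = trans (cong (f v +_) (sumTo-zero n (λ i i< → h i (m≤n⇒m≤1+n i<) (<⇒≢ i<)))) (+-identityʳ _)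
... | no  v≢n  = cong₂ _+_ (h n ≤-refl (≢-sym v≢n))
                   (sumTo-single n v (≤∧≢⇒< (≤-pred v<1+n) v≢n) (λ i i< → h i (m≤n⇒m≤1+n i<)))

equal-1 : ∀ {a b} → a ≡ b → 1 ∸ ((a ∸ b) + (b ∸ a)) ≡ 1
equal-1 {a} refl rewrite n∸n≡0 a = refl

equal-0 : ∀ {a b} → a ≢ b → 1 ∸ ((a ∸ b) + (b ∸ a)) ≡ 0
equal-0 {a} {b} a≢b = ¬0<⇒≡0 λ p → a≢b (holds⇐ (lit {0} a ≐ lit b) {λ _ → 0} {0 ∷ 0 ∷ 0 ∷ 0 ∷ []} {[]} p)

guard-0 : ∀ {a b} → a ≡ 0 → guardℕ a b ≡ 0
guard-0 refl = refl

guard-1 : ∀ {a b} → 0 < a → guardℕ a b ≡ b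
guard-1 {suc _} _ = refl

module Semantics (G : Graph) (k d : ℕ) where

  n : ℕ
  n = order G

  bits : List ℕ
  bits = adjacencyMatrix G

  base : ℕ
  base = (2 + d) * n * n

  adjBit : Vertex G × Vertex G → ℕ
  adjBit (u , v) = if Graph.adj G u v then 1 else 0

  bits-boolean : ∀ a → initial bits a ≤ 1
  bits-boolean = initial-map≤ adjBit bool≤ (cartesianProduct (allFin n) (allFin n))
    where
    bool≤ : ∀ e → adjBit e ≤ 1
    bool≤ (u , v) with Graph.adj G u v
    ... | true  = ≤-refl
    ... | false = z≤n

  bits-length : length bits ≡ n * n
  bits-length = trans (length-row-product adjBit (allFin n)) (cong (_* n) (length-tabulate {n = n} id))

  bits-adj : ∀ x w → 0 < initial bits (toℕ x * n + toℕ w) ⇔ Graph.Adj G x w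
  bits-adj x w = subst (λ b → 0 < b ⇔ Graph.Adj G x w) (sym (initial-row-product adjBit id x w)) (bool (Graph.adj G x w))
    where
    bool : ∀ b → 0 < (if b then 1 else 0) ⇔ T b
    bool true  = mk⇔ (λ _ → _) (λ _ → s≤s z≤n)
    bool false = mk⇔ (λ ()) (λ ())

  layers : ℕ
  layers = (1 + d) * n * n

  open TabulationRun dominationTable k d n bits bits-boolean bits-length (n * n) (layers + (1 + n)) public

  base≡ : n * n + layers ≡ base
  base≡ = sym (*-distribʳ-+ n n ((1 + d) * n))

  entry-at : ∀ H a → ℕ
  entry-at H a = ⟦ entryᴱ ⟧ H (params a) []

  heapAt-stable : ∀ {i a} j → i ≤ j → a < n * n + i → heapAt j a ≡ heapAt i a
  heapAt-stable {i} zero z≤n a< = refl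
  heapAt-stable {i} (suc j) i≤1+j a< with i ≟ suc j
  ... | yes refl = refl
  ... | no  i≢   = trans (≔-other (heapAt j) _ (<⇒≢ (<-≤-trans a< (+-monoʳ-≤ (n * n) i≤j)))) (heapAt-stable j i≤j a<)
    where i≤j = ≤-pred (≤∧≢⇒< i≤1+j i≢)

  heapAt-new : ∀ j → heapAt (suc j) (n * n + j) ≡ entry-at (heapAt j) (n * n + j)
  heapAt-new j = ≔-same (heapAt j) (n * n + j) _

  tail-term : Heap → ℕ → ℕ → ℕ
  tail-term H a v = guardℕ (1 ∸ ((a ∸ (base + suc v)) + ((base + suc v) ∸ a)))
                    ((1 + guardℕ (⟦ indicator (separable zero) ⟧ H (params a) (v ∷ [])) (1 + k)) * H (base + v))

  entry-layer : ∀ H {a} → a < base → entry-at H a ≡ ⟦ indicator layer ⟧ H (params a) []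
  entry-layer H {a} a< = trans (cong₂ _+_ (trans (cong₂ _+_ (guard-1 (m<n⇒0<n∸m a<)) (equal-0 (<⇒≢ a<)))
                                                (+-identityʳ _))
      (sumTo-zero n {tail-term H a} λ v _ → guard-0 (equal-0 (<⇒≢ (<-≤-trans a< (m≤m+n base (suc v)))))))
    (+-identityʳ _)

  not-below : ∀ v {y} → guardℕ (base ∸ (base + v)) y ≡ 0
  not-below v rewrite m≤n⇒m∸n≡0 (m≤m+n base v) = refl

  entry-base : ∀ H → entry-at H base ≡ 1
  entry-base H = cong₂ _+_ (cong₂ _+_ (cong (λ g → guardℕ g (⟦ indicator layer ⟧ H (params base) [])) (n∸n≡0 base)) (equal-1 {base} refl))
    (sumTo-zero n {tail-term H base} λ v _ → guard-0 (equal-0 (<⇒≢ (m<m+n base (s≤s z≤n)))))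

  entry-power : ∀ H {v} → v < n → entry-at H (base + suc v) ≡
    (1 + guardℕ (⟦ indicator (separable zero) ⟧ H (params (base + suc v)) (v ∷ [])) (1 + k)) * H (base + v)
  entry-power H {v} v<n = trans
    (cong₂ _+_ (cong₂ _+_ (not-below (suc v)) (equal-0 (>⇒≢ (m<m+n base (s≤s z≤n)))))
      (sumTo-single n {tail-term H (base + suc v)} v v<n λ i _ i≢v → guard-0
        (equal-0 {base + suc v} {base + suc i} λ e → i≢v (sym (suc-injective (+-cancelˡ-≡ base _ _ e))))))
    (guard-1 (≤-reflexive (sym (equal-1 {base + suc v} refl))))

  HasAdjacency : Heap → Set
  HasAdjacency H = ∀ x w → 0 < H (addr n 0 (toℕ x) (toℕ w)) ⇔ Graph.Adj G x w

  HasLayer : Heap → ℕ → Set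
  HasLayer H t = ∀ x y → 0 < H (addr n (suc t) (toℕ x) (toℕ y)) ⇔ Near (whole G) t x y

  layer⇔near : ∀ {H t x y} → t ≤ d → HasAdjacency H → (∀ {t′} → t ≡ suc t′ → HasLayer H t′) →
    Holds layer H (params (addr n (suc t) (toℕ x) (toℕ y))) [] ⇔ Near (whole G) t x y
  layer⇔near {H} {t} {x} {y} t≤d adj lower = mk⇔ sound (complete lower)
    where
    sound : Holds layer H (params (addr n (suc t) (toℕ x) (toℕ y))) [] → Near (whole G) t x y
    sound (t′ , _ , x′ , x′< , y′ , y′< , eq , rest)
      with addr-injective {n} {suc t} {toℕ x} {toℕ y} {suc t′} {x′} {y′} (toℕ<n x) (toℕ<n y) x′< y′< eq
    sound (_ , _ , _ , _ , _ , _ , _ , inj₁ x≡y) | refl , refl , refl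
      with toℕ-injective x≡y
    ... | refl = stay ∈⊤
    sound (suc t′ , _ , _ , _ , _ , _ , _ , inj₂ (_ , w , w< , e , p)) | refl , refl , refl =
      move (to (adj x (fromℕ< w<)) (subst (λ w → 0 < H (addr n 0 (toℕ x) w)) (sym (toℕ-fromℕ< w<)) e))
           (to (lower refl (fromℕ< w<) y) (subst (λ w → 0 < H (addr n (suc t′) w (toℕ y))) (sym (toℕ-fromℕ< w<)) p))
    complete : (∀ {t′} → t ≡ suc t′ → HasLayer H t′) →
               Near (whole G) t x y → Holds layer H (params (addr n (suc t) (toℕ x) (toℕ y))) []
    complete _ (stay _) = t , s≤s t≤d , toℕ x , toℕ<n x , toℕ x , toℕ<n x , refl , inj₁ refl
    complete lower (move {t = t′} {w = w} e p) = t , s≤s t≤d , toℕ x , toℕ<n x , toℕ y , toℕ<n y , refl ,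
      inj₂ (s≤s z≤n , toℕ w , toℕ<n w , from (adj x w) e , from (lower refl w y) p)

  heapAt-adjacency : ∀ j → HasAdjacency (heapAt j)
  heapAt-adjacency j x w rewrite heapAt-stable {0} {addr n 0 (toℕ x) (toℕ w)} j z≤n
    (≤-trans (addr< {n} {0} {1} ≤-refl (toℕ<n x) (toℕ<n w)) (≤-trans (≤-reflexive (cong (_* n) (*-identityˡ n))) (m≤m+n _ 0)))
    = bits-adj x w

  -- The induction is on the number of filled cells and not on `t`: an entry reads only the level
  -- below its own, which lies at smaller addresses and is complete by then.
  near-at : ∀ j {t x y} → t ≤ d → addr n (suc t) (toℕ x) (toℕ y) < n * n + j →
            0 < heapAt j (addr n (suc t) (toℕ x) (toℕ y)) ⇔ Near (whole G) t x y
  near-at zero {t} {x} {y} _ a< = ⊥-elim (<⇒≱ a< (≤-trans (≤-reflexive (+-identityʳ _))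
    (≤-trans (*-monoˡ-≤ n (≤-trans (m≤m+n n (t * n)) (m≤m+n _ (toℕ x)))) (m≤m+n _ (toℕ y)))))
  near-at (suc j) {t} {x} {y} t≤d a< with addr n (suc t) (toℕ x) (toℕ y) ≟ n * n + j
  ... | no a≢ rewrite ≔-other (heapAt j) (entry-at (heapAt j) (n * n + j)) a≢ =
    near-at j t≤d (≤∧≢⇒< (≤-pred (≤-trans a< (≤-reflexive (+-suc (n * n) j)))) a≢)
  ... | yes a≡ = mk⇔ (λ p → to core (holds⇐ layer {H} {params a} {[]} (subst (0 <_) value p)))
                     (λ p → subst (0 <_) (sym value) (holds⇒ layer {H} {params a} {[]} (from core p)))
    where
    H = heapAt j
    a = addr n (suc t) (toℕ x) (toℕ y)
    value : heapAt (suc j) a ≡ ⟦ indicator layer ⟧ H (params a) []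
    value = trans (cong (heapAt (suc j)) a≡) (trans (heapAt-new j) (trans (cong (entry-at H) (sym a≡))
              (entry-layer H (addr< (s≤s (s≤s t≤d)) (toℕ<n x) (toℕ<n y)))))
    core : Holds layer H (params a) [] ⇔ Near (whole G) t x y
    core = layer⇔near {H} t≤d (heapAt-adjacency j) λ { {t′} refl x′ y′ →
      near-at j (<⇒≤ t≤d) (<-≤-trans (addr< {n} {suc t′} {suc (suc t′)} ≤-refl (toℕ<n x′) (toℕ<n y′))
        (≤-trans (*-monoˡ-≤ n (m≤m+n (suc (suc t′) * n) (toℕ x))) (≤-trans (m≤m+n _ (toℕ y)) (≤-reflexive a≡)))) }

-- Contents of the table: selected vertices

module Selection (G : Graph) (k d : ℕ) where
  open Semantics G k d

  hit? : ∀ u x → Dec (Hit G k d u x)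
  hit? u x = any? λ y → (toℕ y ≟ x) ×-dec near? (whole G) d u y

  hits? : ∀ X u → Dec (Hits G k d X u)
  hits? X u = any? λ i → hit? u (X i)

  -- The history of the scan behind the stored powers. Each decision carries its combinatorial
  -- reason, so that the ladder and the coverage of scanned vertices follow by induction without a
  -- return to the formula `separable`.
  data Trace (H : Heap) : ℕ → List (Vertex G) → Set where
    start : H (base + 0) ≡ 1 → Trace H 0 []
    omit  : ∀ {v W} w → toℕ w ≡ v → H (base + suc v) ≡ H (base + v) →
            (∀ X → All (Hits G k d X) W → Hits G k d X w) → Trace H v W → Trace H (suc v) W
    take  : ∀ {v W} w → toℕ w ≡ v → H (base + suc v) ≡ (2 + k) * H (base + v) →
            ∀ X → ¬ Hits G k d X w → All (Hits G k d X) W → Trace H v W → Trace H (suc v) (w ∷ W)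

  module _ {H : Heap} where

    trace-ladder : ∀ {v W} → Trace H v W → Ladder G k d W
    trace-ladder (start _) = []
    trace-ladder (omit _ _ _ _ t) = trace-ladder t
    trace-ladder (take _ _ _ _ m h t) = rung m h (trace-ladder t)

    trace-bound : ∀ {v W} → Trace H v W → v ≤ n
    trace-bound (start _) = z≤n
    trace-bound (omit w refl _ _ _) = toℕ<n w
    trace-bound (take w refl _ _ _ _ _) = toℕ<n w

    trace-power : ∀ {v W} → Trace H v W → H (base + v) ≡ (2 + k) ^ length W
    trace-power (start e) = e
    trace-power (omit _ _ e _ t) = trans e (trace-power t)
    trace-power (take _ _ e _ _ _ t) = trans e (cong ((2 + k) *_) (trace-power t))

    trace-mono : ∀ {v W} → Trace H v W → ∀ {u} → u ≤ v → H (base + u) ≤ H (base + v)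
    trace-mono (start _) z≤n = ≤-refl
    trace-mono {suc v} (omit _ _ e _ t) {u} u≤ with u ≟ suc v
    ... | yes refl = ≤-refl
    ... | no  u≢   = ≤-trans (trace-mono t (≤-pred (≤∧≢⇒< u≤ u≢))) (≤-reflexive (sym e))
    trace-mono {suc v} (take _ _ e _ _ _ t) {u} u≤ with u ≟ suc v
    ... | yes refl = ≤-refl
    ... | no  u≢   = ≤-trans (trace-mono t (≤-pred (≤∧≢⇒< u≤ u≢)))
                       (≤-trans (m≤m+n _ _) (≤-reflexive (sym e)))

    trace-positive : ∀ {v W} → Trace H v W → ∀ {u} → u ≤ v → 0 < H (base + u)
    trace-positive (start e) z≤n = ≤-reflexive (sym e)
    trace-positive {suc v} (omit _ _ e _ t) {u} u≤ with u ≟ suc v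
    ... | yes refl = ≤-trans (trace-positive t ≤-refl) (≤-reflexive (sym e))
    ... | no  u≢   = trace-positive t (≤-pred (≤∧≢⇒< u≤ u≢))
    trace-positive {suc v} (take _ _ e _ _ _ t) {u} u≤ with u ≟ suc v
    ... | yes refl = ≤-trans (trace-positive t ≤-refl) (≤-trans (m≤m+n _ _) (≤-reflexive (sym e)))
    ... | no  u≢   = trace-positive t (≤-pred (≤∧≢⇒< u≤ u≢))

    trace-selected : ∀ {v W} → Trace H v W → ∀ u → toℕ u < v →
                     H (base + toℕ u) < H (base + suc (toℕ u)) → u ∈ᴸ W
    trace-selected {suc v} (omit w refl e _ t) u u<1+v h with toℕ u ≟ v
    ... | no  u≢v = trace-selected t u (≤∧≢⇒< (≤-pred u<1+v) u≢v) h
    ... | yes u≡v = ⊥-elim (<-irrefl (sym (subst (λ u → H (base + suc u) ≡ H (base + u)) (sym u≡v) e)) h)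
    trace-selected {suc v} (take w refl e _ _ _ t) u u<1+v h with toℕ u ≟ v
    ... | no  u≢v = there (trace-selected t u (≤∧≢⇒< (≤-pred u<1+v) u≢v) h)
    ... | yes u≡v = here (toℕ-injective u≡v)

    -- The last component is divisibility: every later power is a multiple of the one just after
    -- `u`. Adding digits of later vertices to a code therefore leaves the digit of `u` unchanged.
    trace-∈ : ∀ {v W} → Trace H v W → ∀ {u} → u ∈ᴸ W →
              toℕ u < v × H (base + suc (toℕ u)) ≡ (2 + k) * H (base + toℕ u) ×
              ∃[ z ] H (base + v) ≡ z * H (base + suc (toℕ u))
    trace-∈ (omit _ _ e _ t) u∈ with trace-∈ t u∈
    ... | u< , eq , z , ez = m≤n⇒m≤1+n u< , eq , z , trans e ez
    trace-∈ (take w refl e _ _ _ t) (here refl) = ≤-refl , e , 1 , sym (+-identityʳ _)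
    trace-∈ {suc v} (take _ _ e _ _ _ t) {u} (there u∈) with trace-∈ t u∈
    ... | u< , eq , z , ez = m≤n⇒m≤1+n u< , eq , (2 + k) * z ,
      trans e (trans (cong ((2 + k) *_) ez) (sym (*-assoc (2 + k) z (H (base + suc (toℕ u))))))

    trace-chosen : ∀ {v W} → Trace H v W → ∀ {u} → u ∈ᴸ W → H (base + toℕ u) < H (base + suc (toℕ u))
    trace-chosen t u∈ with trace-∈ t u∈
    ... | u< , eq , _ =
      <-≤-trans (m<m+n _ (<-≤-trans (trace-positive t (<⇒≤ u<)) (m≤m+n _ _))) (≤-reflexive (sym eq))

    -- Hitting the final list entails hitting the list as it was when `u` was scanned, and to that
    -- earlier list the reason stored in `omit` applies.
    trace-covered : ∀ {v W X} → Trace H v W → All (Hits G k d X) W → ∀ u → toℕ u < v → Hits G k d X u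
    trace-covered {suc v} {X = X} (omit w refl _ c t) hs u u< with toℕ u ≟ v
    ... | yes u≡v = subst (Hits G k d X) (sym (toℕ-injective u≡v)) (c _ hs)
    ... | no  u≢v = trace-covered t hs u (≤∧≢⇒< (≤-pred u<) u≢v)
    trace-covered {suc v} {X = X} (take w refl _ _ _ _ t) (h ∷ hs) u u< with toℕ u ≟ v
    ... | yes u≡v = subst (Hits G k d X) (sym (toℕ-injective u≡v)) h
    ... | no  u≢v = trace-covered t hs u (≤∧≢⇒< (≤-pred u<) u≢v)

  trace-cong : ∀ {H H′ v W} → (∀ u → u ≤ v → H′ (base + u) ≡ H (base + u)) → Trace H v W → Trace H′ v W
  trace-cong h (start e) = start (trans (h 0 z≤n) e)
  trace-cong {v = suc v} h (omit w p e c t) =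
    omit w p (trans (h _ ≤-refl) (trans e (sym (h v (n≤1+n v))))) c (trace-cong (λ u u≤ → h u (m≤n⇒m≤1+n u≤)) t)
  trace-cong {v = suc v} h (take w p e X m hs t) =
    take w p (trans (h _ ≤-refl) (trans e (cong ((2 + k) *_) (sym (h v (n≤1+n v)))))) X m hs
      (trace-cong (λ u u≤ → h u (m≤n⇒m≤1+n u≤)) t)

  Digit : Heap → ℕ → ℕ → ℕ → Set
  Digit H u c i = ∃[ q ] q < 1 + c × ∃[ r ] r < H (base + u) × c ≡ q * H (base + suc u) + i * H (base + u) + r

  -- The code of the digits φ u, for the selected vertices u, is the sum of φ u · H (base + u).
  trace-code : ∀ {H v W} → Trace H v W → (φ : Vertex G → ℕ) → (∀ u → φ u < 2 + k) →
               ∃[ c ] c < H (base + v) × (∀ u → u ∈ᴸ W → Digit H (toℕ u) c (φ u))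
  trace-code (start e) φ φ< = 0 , ≤-reflexive (sym e) , λ u ()
  trace-code (omit _ _ e _ t) φ φ< with trace-code t φ φ<
  ... | c , c< , digits = c , <-≤-trans c< (≤-reflexive (sym e)) , digits
  trace-code {H} (take {v} w refl e _ _ _ t) φ φ< with trace-code t φ φ<
  ... | c , c< , digits = c + φ w * h , below , digits′
    where
    h = H (base + toℕ w)
    below : c + φ w * h < H (base + suc (toℕ w))
    below = <-≤-trans (+-monoˡ-< (φ w * h) c<) (≤-trans (*-monoˡ-≤ h (φ< w)) (≤-reflexive (sym e)))
    digits′ : ∀ u → u ∈ᴸ w ∷ _ → Digit H (toℕ u) (c + φ w * h) (φ u)
    digits′ u (here refl) = 0 , s≤s z≤n , c , c< , +-comm c (φ u * h)
    digits′ u (there u∈) with digits u u∈ | trace-∈ t u∈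
    ... | q , q< , r , r< , eq | u< , _ , z , ez =
      q + φ w * z , s≤s (≤-trans (m≤m*n _ P) (≤-trans (≤-trans (m≤m+n _ _) (m≤m+n _ r)) (≤-reflexive (sym total)))) , r , r< , total
      where
      P = H (base + suc (toℕ u))
      instance
        P≢0 : NonZero P
        P≢0 = >-nonZero (trace-positive t u<)
      rearrange : ∀ q P x r f z → q * P + x + r + f * (z * P) ≡ (q + f * z) * P + x + r
      rearrange = solve-∀
      total : c + φ w * h ≡ (q + φ w * z) * P + φ u * H (base + toℕ u) + r
      total = trans (cong₂ (λ c h → c + φ w * h) eq ez) (rearrange q P _ r (φ w) z)

  -- Division with remainder is unique, first by the power at `u` and then, for the quotient, by the
  -- base k + 2.
  digit-unique : ∀ {H u c i i′} → H (base + suc u) ≡ (2 + k) * H (base + u) → i < 2 + k → i′ < 2 + k →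
                 Digit H u c i → Digit H u c i′ → i ≡ i′
  digit-unique {H} {u} {i = i} {i′} e i< i′< (q , _ , r , r< , eq) (q′ , _ , r′ , r′< , eq′)
    with divmod-unique {q = q * (2 + k) + i} {q′ * (2 + k) + i′} r< r′<
           (trans (rearrange q i r) (trans (sym eq) (trans eq′ (sym (rearrange q′ i′ r′)))))
    where
    regroup : ∀ q b i h r → (q * b + i) * h + r ≡ q * (b * h) + i * h + r
    regroup = solve-∀
    rearrange : ∀ q i r → (q * (2 + k) + i) * H (base + u) + r ≡ q * H (base + suc u) + i * H (base + u) + r
    rearrange q i r = trans (regroup q (2 + k) i (H (base + u)) r) (cong (λ p → q * p + i * H (base + u) + r) (sym e))
  ... | eq″ , _ = proj₂ (divmod-unique {q = q} {q′} i< i′< eq″)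

  NearIn : Heap → ℕ → ℕ → Set
  NearIn H u x = u < n × x < n × 0 < H (addr n (1 + d) u x)

  -- Quantifying over vertices numbered `v` makes the first condition vacuous at `v = n`, so the
  -- final question is an instance of the same test.
  Separates : ℕ → List (Vertex G) → (Fin k → ℕ) → Set
  Separates v W X = (∀ w → toℕ w ≡ v → ¬ Hits G k d X w) × All (Hits G k d X) W

  module _ {H : Heap} (hasLayer : HasLayer H d) where

    near⇒hit : ∀ {u x} → NearIn H (toℕ u) x → Hit G k d u x
    near⇒hit {u} {x} (_ , x< , p) = fromℕ< x< , toℕ-fromℕ< x< ,
      to (hasLayer u (fromℕ< x<)) (subst (λ x → 0 < H (addr n (1 + d) (toℕ u) x)) (sym (toℕ-fromℕ< x<)) p)

    hit⇒near : ∀ {u x} → Hit G k d u x → NearIn H (toℕ u) x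
    hit⇒near {u} (y , refl , p) = toℕ<n u , toℕ<n y , from (hasLayer u y) p

    separable-sound : ∀ {v W} a → Trace H v W → Holds (separable zero) H (params a) (v ∷ []) → ∃[ X ] Separates v W X
    separable-sound {v} {W} a t (c , _ , covered , classes) = X , misses , All.tabulate hits
      where
      X : Fin k → ℕ
      X i = proj₁ (classes (toℕ i) (toℕ<n i))
      misses : ∀ w → toℕ w ≡ v → ¬ Hits G k d X w
      misses w refl (i , hit) = proj₁ (proj₂ (proj₂ (classes (toℕ i) (toℕ<n i)))) (hit⇒near hit)
      hits : ∀ {u} → u ∈ᴸ W → Hits G k d X u
      hits {u} u∈ with trace-∈ t u∈
      ... | u< , _ with covered (toℕ u) u< (trace-chosen t u∈)
      ... | i , i<k , digit with proj₂ (proj₂ (proj₂ (classes (toℕ (fromℕ< i<k)) (toℕ<n (fromℕ< i<k))))) (toℕ u) u<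
                                   (trace-chosen t u∈ , subst (Digit H (toℕ u) c) (sym (toℕ-fromℕ< i<k)) digit)
      ... | p = fromℕ< i<k , near⇒hit p

    class : (Fin k → ℕ) → Vertex G → ℕ
    class X u with hits? X u
    ... | yes (i , _) = toℕ i
    -- A default below the base, available even for k = 0; only vertices that are hit get decoded.
    ... | no  _       = 0

    class< : ∀ X u → class X u < 2 + k
    class< X u with hits? X u
    ... | yes (i , _) = m≤n⇒m≤1+n (m≤n⇒m≤1+n (toℕ<n i))
    ... | no  _       = s≤s z≤n

    class-hit : ∀ X {u} → Hits G k d X u → ∃[ i ] toℕ i ≡ class X u × Hit G k d u (X i)
    class-hit X {u} hits with hits? X u
    ... | yes (i , hit) = i , refl , hit
    ... | no  ¬hits     = ⊥-elim (¬hits hits)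

    by-vertex : ∀ (P : ℕ → Set) → (∀ (u : Vertex G) → P (toℕ u)) → ∀ u → u < n → P u
    by-vertex P h u u<n = subst P (toℕ-fromℕ< u<n) (h (fromℕ< u<n))

    separable-complete : ∀ {v W} a → Trace H v W → ∃[ X ] Separates v W X → Holds (separable zero) H (params a) (v ∷ [])
    separable-complete {v} {W} a t (X , misses , hits) with trace-code t (class X) (class< X)
    ... | c , c< , digits = c , c< ,
      (λ u u<v → by-vertex (λ u → u < v → H (base + u) < H (base + suc u) → ∃[ i ] i < k × Digit H u c i)
                   covered u (<-≤-trans u<v (trace-bound t)) u<v) ,
      λ i i<k → centre i<k , s≤s (m⊓n≤n (X (fromℕ< i<k)) n) , missed i<k ,
        λ u u<v → by-vertex (λ u → u < v → H (base + u) < H (base + suc u) × Digit H u c i → NearIn H u (centre i<k))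
                    (hit i<k) u (<-≤-trans u<v (trace-bound t)) u<v
      where
      covered : ∀ u → toℕ u < v → H (base + toℕ u) < H (base + suc (toℕ u)) → ∃[ i ] i < k × Digit H (toℕ u) c i
      covered u u< chosen with trace-selected t u u< chosen
      ... | u∈ with class-hit X (All.lookup hits u∈)
      ...   | i , i≡ , _ = class X u , subst (_< k) i≡ (toℕ<n i) , digits u u∈
      -- Absent centres may be arbitrarily large numbers, while the quantifier stops at n; all of
      -- them become n.
      centre : ∀ {i} → i < k → ℕ
      centre i<k = X (fromℕ< i<k) ⊓ n
      missed : ∀ {i} (i<k : i < k) → ¬ NearIn H v (centre i<k)
      missed i<k near@(v<n , x<n , _) = misses (fromℕ< v<n) (toℕ-fromℕ< v<n)
        (fromℕ< i<k , subst (Hit G k d (fromℕ< v<n)) x≡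
          (near⇒hit (subst (λ v → NearIn H v (centre i<k)) (sym (toℕ-fromℕ< v<n)) near)))
        where
        x≡ : centre i<k ≡ X (fromℕ< i<k)
        x≡ = m≤n⇒m⊓n≡m (≮⇒≥ λ n<X → <-irrefl (m≥n⇒m⊓n≡n (<⇒≤ n<X)) x<n)
      hit : ∀ {i} (i<k : i < k) u → toℕ u < v → H (base + toℕ u) < H (base + suc (toℕ u)) × Digit H (toℕ u) c i →
            NearIn H (toℕ u) (centre i<k)
      hit {i} i<k u u< (chosen , digit) with trace-selected t u u< chosen
      ... | u∈ with class-hit X (All.lookup hits u∈)
      ...   | j , j≡ , h@(y , y≡ , _) = subst (NearIn H (toℕ u)) (sym x≡) (hit⇒near (subst (Hit G k d u) (cong X j≡i) h))
        where
        -- The formula demands nearness for every vertex that can be decoded to `i`, so the decoding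
        -- has to be unique.
        i≡ : class X u ≡ i
        i≡ = digit-unique {H} {toℕ u} (proj₁ (proj₂ (trace-∈ t u∈))) (class< X u) (m≤n⇒m≤1+n (m≤n⇒m≤1+n i<k)) (digits u u∈) digit
        j≡i : j ≡ fromℕ< i<k
        j≡i = toℕ-injective (trans j≡ (trans i≡ (sym (toℕ-fromℕ< i<k))))
        x≡ : centre i<k ≡ X (fromℕ< i<k)
        x≡ = m≤n⇒m⊓n≡m (subst (_≤ n) (trans y≡ (cong X j≡i)) (<⇒≤ (toℕ<n y)))

-- Correctness and loop bounds

guardℕ≤ : ∀ a {b} → guardℕ a b ≤ b
guardℕ≤ zero    = z≤n
guardℕ≤ (suc _) = ≤-refl

positive⇔1 : ∀ {a} → 1 ∸ (1 ∸ a) ≡ 1 ⇔ 0 < a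
positive⇔1 {zero}  = mk⇔ (λ ()) (λ ())
positive⇔1 {suc a} = mk⇔ (λ _ → s≤s z≤n) (λ _ → cong (1 ∸_) (0∸n≡0 a))

module Domination (G : Graph) (k d : ℕ) where
  open Semantics G k d
  open Selection G k d

  address≡ : ∀ v → n * n + (layers + v) ≡ base + v
  address≡ v = trans (sym (+-assoc (n * n) layers v)) (cong (_+ v) base≡)

  has-layer : ∀ j → layers ≤ j → HasLayer (heapAt j) d
  has-layer j layers≤j x y = near-at j ≤-refl
    (<-≤-trans (addr< {n} {suc d} {2 + d} ≤-refl (toℕ<n x) (toℕ<n y))
      (≤-trans (≤-reflexive (sym base≡)) (+-monoʳ-≤ (n * n) layers≤j)))

  heapAt-base : ∀ v → heapAt (suc (layers + v)) (base + v) ≡ entry-at (heapAt (layers + v)) (base + v)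
  heapAt-base v = subst (λ a → heapAt (suc (layers + v)) a ≡ entry-at (heapAt (layers + v)) a) (address≡ v) (heapAt-new (layers + v))

  module _ (H : Heap) (hasLayer : HasLayer H d) {v W} (v<n : v < n) (t : Trace H v W) where

    private
      w : Vertex G
      w = fromℕ< v<n

      w≡v : toℕ w ≡ v
      w≡v = toℕ-fromℕ< v<n

      at-w : ∀ {u} → toℕ u ≡ v → u ≡ w
      at-w u≡v = toℕ-injective (trans u≡v (sym w≡v))

    -- Abstracting the value of the test as `b` permits the case distinction without unfolding the
    -- expression.
    extend : ∀ {H′} → (∀ u → u ≤ v → H′ (base + u) ≡ H (base + u)) →
             ∀ b → (0 < b ⇔ (∃[ X ] Separates v W X)) →
             H′ (base + suc v) ≡ (1 + guardℕ b (1 + k)) * H (base + v) → ∃[ W′ ] Trace H′ (suc v) W′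
    extend old (suc b) test new =
      let (X , misses , hits) = to test (s≤s z≤n) in
      w ∷ W , take w w≡v (trans new (cong ((2 + k) *_) (sym (old v ≤-refl)))) X (misses w w≡v) hits (trace-cong old t)
    extend old zero test new =
      W , omit w w≡v (trans new (trans (+-identityʳ _) (sym (old v ≤-refl)))) covered (trace-cong old t)
      where
      covered : ∀ X → All (Hits G k d X) W → Hits G k d X w
      covered X hits with hits? X w
      -- Failure of the test only refutes the existence of a separating tuple; decidability of
      -- `Hits` turns this into coverage by every tuple.
      ... | yes h = h
      ... | no ¬h = ⊥-elim (n≮0 (from test (X , (λ u u≡v h → ¬h (subst (Hits G k d X) (at-w u≡v) h)) , hits)))

    separable⇔ : ∀ a → 0 < ⟦ indicator (separable zero) ⟧ H (params a) (v ∷ []) ⇔ (∃[ X ] Separates v W X)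
    separable⇔ a = mk⇔ (λ p → separable-sound {H} hasLayer a t (holds⇐ (separable zero) {H} {params a} {v ∷ []} p))
                       (λ s → holds⇒ (separable zero) {H} {params a} {v ∷ []} (separable-complete {H} hasLayer a t s))

  -- Scanning `v` vertices requires the `v + 1` cells from `base` to `base + v`, hence `suc v`.
  traceAt : ∀ v → v ≤ n → ∃[ W ] Trace (heapAt (layers + suc v)) v W
  traceAt zero _ = [] , start (trans (cong (λ j → heapAt j (base + 0)) (+-suc layers 0)) (trans (heapAt-base 0)
    (subst (λ b → entry-at (heapAt (layers + 0)) b ≡ 1) (sym (+-identityʳ base)) (entry-base (heapAt (layers + 0))))))
  traceAt (suc v) v<n =
    let j = layers + suc v
        H = heapAt j
        hasLayer = has-layer j (m≤m+n layers (suc v))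
        (_ , t) = traceAt v (<⇒≤ v<n)
        H′≡ = λ c → cong (λ j → heapAt j c) (+-suc layers (suc v))
    in extend H hasLayer v<n t
         (λ u u≤v → trans (H′≡ (base + u)) (heapAt-stable (suc j) (n≤1+n j)
           (<-≤-trans (+-monoʳ-< base (s≤s u≤v)) (≤-reflexive (sym (address≡ (suc v)))))))
         (⟦ indicator (separable zero) ⟧ H (params (base + suc v)) (v ∷ []))
         (separable⇔ H hasLayer v<n t (base + suc v))
         (trans (H′≡ (base + suc v)) (trans (heapAt-base (suc v)) (entry-power H v<n)))

  collect : ∀ {m} → (Fin m → ℕ) → List (Vertex G)
  collect {zero}  X = []
  collect {suc m} X with X zero <? n
  ... | yes x<n = fromℕ< x<n ∷ collect (λ i → X (suc i))
  ... | no  _   = collect (λ i → X (suc i))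

  collect-length : ∀ {m} (X : Fin m → ℕ) → length (collect X) ≤ m
  collect-length {zero}  X = z≤n
  collect-length {suc m} X with X zero <? n
  ... | yes x<n = s≤s (collect-length (λ i → X (suc i)))
  ... | no  _   = m≤n⇒m≤1+n (collect-length (λ i → X (suc i)))

  ∈-collect : ∀ {m} (X : Fin m → ℕ) i {y} → toℕ y ≡ X i → y ∈ᴸ collect X
  ∈-collect {suc m} X i       y≡ with X zero <? n
  ∈-collect {suc m} X zero    y≡ | yes x<n = here (toℕ-injective (trans y≡ (sym (toℕ-fromℕ< x<n))))
  ∈-collect {suc m} X (suc i) y≡ | yes x<n = there (∈-collect (λ i → X (suc i)) i y≡)
  ∈-collect {suc m} X zero {y} y≡ | no x≮n = ⊥-elim (x≮n (subst (_< n) y≡ (toℕ<n y)))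
  ∈-collect {suc m} X (suc i) y≡ | no _    = ∈-collect (λ i → X (suc i)) i y≡

  -- A dominating set with fewer than k vertices is completed to a k-tuple by the absent centre n.
  pad : List (Vertex G) → ℕ → ℕ
  pad []       _       = n
  pad (x ∷ xs) zero    = toℕ x
  pad (x ∷ xs) (suc i) = pad xs i

  ∈-pad : ∀ {x xs} → x ∈ᴸ xs → ∃[ i ] i < length xs × pad xs i ≡ toℕ x
  ∈-pad (here refl) = 0 , s≤s z≤n , refl
  ∈-pad (there x∈) with ∈-pad x∈
  ... | i , i< , eq = suc i , s≤s i< , eq

  dominating⇔ : (∃[ X ] (∀ u → Hits G k d X u)) ⇔ HasDominatingSet G k d
  dominating⇔ = mk⇔ dominate hit
    where
    dominate : ∃[ X ] (∀ u → Hits G k d X u) → HasDominatingSet G k d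
    dominate (X , hits) = fromList (collect X) , ≤-trans (∣fromList∣≤length (collect X)) (collect-length X) , close
      where
      close : ∀ v → ∃[ x ] x ∈ fromList (collect X) × DistanceAtMost (whole G) d v x
      close v with hits v
      ... | i , y , y≡ , p = y , ∈-fromList⁺ (∈-collect X i y≡) , near⇒distance≤ (whole G) ≤-refl p
    hit : HasDominatingSet G k d → ∃[ X ] (∀ u → Hits G k d X u)
    hit (D , ∣D∣≤k , close) with elements D
    ... | xs , length≡ , D⊆xs = (λ i → pad xs (toℕ i)) , hits
      where
      hits : ∀ u → Hits G k d (λ i → pad xs (toℕ i)) u
      hits u with close u
      ... | x , x∈ , dist with ∈-pad (D⊆xs x∈)
      ...   | i , i< , eq = fromℕ< i<k , x , trans (sym eq) (cong (pad xs) (sym (toℕ-fromℕ< i<k))) , distance≤⇒near (whole G) dist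
        where
        i<k : i < k
        i<k = <-≤-trans i< (≤-trans (≤-reflexive length≡) ∣D∣≤k)

  answer-correct : ⟦ answerᴱ ⟧ (heapAt (layers + suc n)) (params (n * n + (layers + suc n))) [] ≡ 1 ⇔ HasDominatingSet G k d
  answer-correct with traceAt n ≤-refl
  ... | W , t = mk⇔ (λ e → to dominating⇔ (sound (holds⇐ φ {H} {γ} {[]} (to positive⇔1 e))))
                    (λ D → from positive⇔1 (holds⇒ φ {H} {γ} {[]} (complete (from dominating⇔ D))))
    where
    H = heapAt (layers + suc n)
    γ = params (n * n + (layers + suc n))
    φ : Formula 0
    φ = ∃ᶠ (lit 1 ⊕ nᴱ) (v₀ ≐ nᴱ ∧ᶠ separable zero)
    layer-d = has-layer (layers + suc n) (m≤m+n layers (suc n))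
    sound : Holds φ H γ [] → ∃[ X ] (∀ u → Hits G k d X u)
    sound (_ , _ , refl , h) with separable-sound {H} layer-d (n * n + (layers + suc n)) t h
    ... | X , _ , hits = X , λ u → trace-covered t hits u (toℕ<n u)
    complete : ∃[ X ] (∀ u → Hits G k d X u) → Holds φ H γ []
    complete (X , hits) = n , ≤-refl , refl , separable-complete {H} layer-d (n * n + (layers + suc n)) t
      (X , (λ w w≡n _ → <-irrefl w≡n (toℕ<n w)) , All.tabulate (λ {u} _ → hits u))

  -- The loops have polynomial ranges except those governed by stored powers. Quasi-wideness enters
  -- only through `power≤Z`.
  module Safety (Z : ℕ) (2+d≤Z : 2 + d ≤ Z) (dn≤Z : (2 + d) * n ≤ Z) (1+n≤Z : 1 + n ≤ Z) (2+k≤Z : 2 + k ≤ Z)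
                (power≤Z : ∀ {W} → Ladder G k d W → (2 + k) ^ length W ≤ Z) where

    private
      n≤Z = <⇒≤ 1+n≤Z
      k≤Z = ≤-trans (m≤n+m k 2) 2+k≤Z

      row≤Z : ∀ {t x} → t ≤ 1 + d → x < n → t * n + x ≤ Z
      row≤Z {t} t≤ x< = <⇒≤ (<-≤-trans (m*n+r<[1+m]*n t x<) (≤-trans (*-monoˡ-≤ n (s≤s t≤)) dn≤Z))

      base-safe : ∀ {m} H a ρ → Safe {m} Z baseᴱ H (params a) ρ
      base-safe H a ρ = (_ , _ , 2+d≤Z) , _ , dn≤Z

    layer-safe : ∀ H a → SafeFormula Z layer H (params a) []
    layer-safe H a = _ , <⇒≤ 2+d≤Z , λ t t< → _ , n≤Z , λ x x< → _ , n≤Z , λ y y< →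
      (_ , ((((_ , _) , _ , ≤-trans t< (<⇒≤ 2+d≤Z)) , _) , _ , row≤Z t< x<) , _) , λ _ → _ , _ , λ 0<t →
      _ , n≤Z , λ w w< → (_ , (((_ , _ , z≤n) , _) , _ , row≤Z z≤n x<) , _) ,
      λ _ → _ , (((_ , _ , ≤-trans (<⇒≤ t<) (<⇒≤ 2+d≤Z)) , _) , _ , row≤Z (<⇒≤ t<) w<) , _

    -- Stored powers are loop ranges here. The trace bounds them all by the last one, which is (k +
    -- 2)^|W| for a ladder W.
    separable-safe : ∀ {H v W} a → Trace H v W → SafeFormula Z (separable zero) H (params a) (v ∷ [])
    separable-safe {H} {v} {W} a t =
      power-safe (v ∷ []) , power≤ ≤-refl , λ c c< →
        (_ , v≤Z , λ u u< → selected-safe (u ∷ c ∷ v ∷ []) , λ _ → _ , k≤Z , λ i i< →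
          digit-safe (i ∷ u ∷ c ∷ v ∷ []) {suc zero} {suc (suc zero)} {zero} u< c< i<) ,
        λ _ → _ , k≤Z , λ i i< → _ , 1+n≤Z , λ x x< →
          near-safe (x ∷ i ∷ c ∷ v ∷ []) {suc (suc (suc zero))} {zero} , λ _ → _ , v≤Z , λ u u< →
          (selected-safe (u ∷ x ∷ i ∷ c ∷ v ∷ []) , λ _ →
            digit-safe (u ∷ x ∷ i ∷ c ∷ v ∷ []) {zero} {suc (suc (suc zero))} {suc (suc zero)} u< c< i<) ,
          λ _ → near-safe (u ∷ x ∷ i ∷ c ∷ v ∷ []) {zero} {suc zero}
      where
      v≤Z : v ≤ Z
      v≤Z = ≤-trans (trace-bound t) n≤Z
      power≤ : ∀ {u} → u ≤ v → H (base + u) ≤ Z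
      power≤ u≤ = ≤-trans (trace-mono t u≤) (≤-trans (≤-reflexive (trace-power t)) (power≤Z (trace-ladder t)))
      power-safe : ∀ {m} ρ → Safe {m} Z baseᴱ H (params a) ρ × ⊤
      power-safe ρ = base-safe H a ρ , _
      selected-safe : ∀ {m} ρ → SafeFormula {suc m} Z (selected zero) H (params a) ρ
      selected-safe ρ = power-safe ρ , base-safe H a ρ , _
      near-safe : ∀ {m} ρ {i j : Fin m} → SafeFormula Z (near i j) H (params a) ρ
      near-safe ρ = _ , λ u<n → _ , λ x<n → _ , ((((_ , _) , _ , <⇒≤ 2+d≤Z) , _) , _ , row≤Z ≤-refl u<n) , _
      digit-safe : ∀ {m} ρ {u c i : Fin m} → ⟦ var u ⟧ H (params a) ρ < v → ⟦ var c ⟧ H (params a) ρ < H (base + v) →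
                   ⟦ var i ⟧ H (params a) ρ < k → SafeFormula Z (digit u c i) H (params a) ρ
      digit-safe ρ u< c< i< = _ , 1+c≤Z , λ q q< → power-safe (q ∷ ρ) , power≤ (<⇒≤ u<) , λ r r< → _ ,
        ((_ , (base-safe H a (r ∷ q ∷ ρ) , _) , <⇒≤ (<-≤-trans q< 1+c≤Z)) ,
         (_ , power-safe (r ∷ q ∷ ρ) , ≤-trans (<⇒≤ i<) k≤Z)) , _
        where
        1+c≤Z = ≤-trans c< (power≤ ≤-refl)

    -- A trace is demanded only at an address `base + suc v`, because elsewhere the guard keeps
    -- `separable` from being evaluated.
    entry-safe-at : ∀ H a → (∀ v → v < n → a ≡ base + suc v → ∃[ W ] Trace H v W) → Safe Z entryᴱ H (params a) []
    entry-safe-at H a trace =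
      ((indicator-safe (aᴱ ≺ baseᴱ) {H} {params a} {[]} (_ , base-safe H a []) ,
        λ _ → indicator-safe layer {H} {params a} {[]} (layer-safe H a)) ,
       indicator-safe (aᴱ ≐ baseᴱ) {H} {params a} {[]} (_ , base-safe H a [])) ,
      (_ , n≤Z , λ v v<n →
        indicator-safe (aᴱ ≐ baseᴱ ⊕ (lit 1 ⊕ v₀)) {H} {params a} {v ∷ []} (_ , base-safe H a (v ∷ []) , _ , _) , λ p →
        ((_ , indicator-safe (separable zero) {H} {params a} {v ∷ []} (separable-safe a
               (proj₂ (trace v v<n (holds⇐ (aᴱ ≐ baseᴱ ⊕ (lit 1 ⊕ v₀)) {H} {params a} {v ∷ []} p)))) , λ _ → _) ,
         (base-safe H a (v ∷ []) , _) ,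
         ≤-trans (s≤s (guardℕ≤ (⟦ indicator (separable zero) ⟧ H (params a) (v ∷ [])))) 2+k≤Z))

    bounded : n * n ≤ Z → layers + suc n ≤ Z → Bounded Z
    bounded nn≤Z L≤Z = record
      { n≤Z = n≤Z ; n*n≤Z = nn≤Z ; L≤Z = L≤Z
      ; start-value = λ _ → refl ; count-value = refl
      ; start-safe = λ _ → _ , _ , n≤Z
      ; count-safe = ((_ , _ , <⇒≤ 2+d≤Z) , _ , ≤-trans (m≤n+m _ n) dn≤Z) , _
      ; entry-safe = λ j _ → entry-safe-at (heapAt j) (n * n + j) λ v v<n e →
          subst (λ j → ∃[ W ] Trace (heapAt j) v W) (sym (+-cancelˡ-≡ (n * n) j (layers + suc v) (trans e (sym (address≡ (suc v))))))
            (traceAt v (<⇒≤ v<n))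
      ; answer-safe = _ , _ , indicator-safe (∃ᶠ (lit 1 ⊕ nᴱ) (v₀ ≐ nᴱ ∧ᶠ separable zero))
          {heapAt (layers + suc n)} {params (n * n + (layers + suc n))} {[]}
          (_ , 1+n≤Z , λ v _ → _ , λ { refl → separable-safe (n * n + (layers + suc n)) (proj₂ (traceAt n ≤-refl)) })
      }

-- Running time

ladderBound : (ℕ → ℕ) → (ℕ → ℕ → ℕ) → ℕ → ℕ
ladderBound s N p = N p (scatteredSize s p)

-- The power of 4 + p dominates the number of codes, and the extra factor 4 + p covers coefficients
-- linear in k or d, such as (1 + d) + 2 in the count of table cells.
parameterFactor : (ℕ → ℕ) → (ℕ → ℕ → ℕ) → ℕ → ℕ
parameterFactor s N p = (4 + p) ^ suc (ladderBound s N p)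

computable-parameterFactor : ∀ {s N} → Computable₁ s → Computable₂ N → Computable₁ (parameterFactor s N)
computable-parameterFactor {s} {N} cs cN =
  computable-∘₂ computable-flip-^
    (computable-∘ computable-suc (computable-∘₂ cN computable-id
      (computable-∘ computable-suc (computable-∘₂ computable-*
        (computable-∘₂ computable-flip-^ cs 2+-computable) computable-suc))))
    (computable-∘ computable-suc (computable-∘ computable-suc 2+-computable))
  where
  2+-computable : Computable₁ (2 +_)
  2+-computable = computable-∘ computable-suc computable-suc

module _ {C s N} (uqw : UniformlyQuasiWide C s N) (G : Graph) (G∈C : C G) (k d : ℕ) where

  private
    n n′ p g Q Z : ℕ
    n  = order G
    n′ = 1 ⊔ n
    p  = k + d
    g  = 4 + p
    Q  = parameterFactor s N p
    Z  = Q * n′ ^ 2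

    1≤n′ : 1 ≤ n′
    1≤n′ = m≤m⊔n 1 n
    n≤n′ : n ≤ n′
    n≤n′ = m≤n⊔m 1 n

    n′≤n′² : n′ ≤ n′ ^ 2
    n′≤n′² = ≤-trans (≤-reflexive (sym (*-identityʳ n′))) (≤-trans (*-monoʳ-≤ n′ 1≤n′) (≤-reflexive (cong (n′ *_) (sym (*-identityʳ n′)))))

    nn≤n′² : n * n ≤ n′ ^ 2
    nn≤n′² = ≤-trans (*-mono-≤ n≤n′ n≤n′) (≤-reflexive (cong (n′ *_) (sym (*-identityʳ n′))))

    g≤Q : g ≤ Q
    g≤Q = ≤-trans (≤-reflexive (sym (*-identityʳ g))) (*-monoʳ-≤ g (m^n>0 g (ladderBound s N p)))

    scale : ∀ {a b} → a ≤ g → b ≤ n′ ^ 2 → a * b ≤ Z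
    scale a≤g b≤ = *-mono-≤ (≤-trans a≤g g≤Q) b≤

    1+n≤2n′² : 1 + n ≤ 2 * n′ ^ 2
    1+n≤2n′² = ≤-trans (+-mono-≤ (≤-trans 1≤n′ n′≤n′²) (≤-trans n≤n′ n′≤n′²))
                 (≤-reflexive (cong (n′ ^ 2 +_) (sym (+-identityʳ (n′ ^ 2)))))

    small : ∀ {a} → a ≤ g → a ≤ Z
    small {a} a≤g = ≤-trans (≤-reflexive (sym (*-identityʳ a))) (scale a≤g (≤-trans 1≤n′ n′≤n′²))

    d≤p : d ≤ p
    d≤p = m≤n+m d k
    k≤p : k ≤ p
    k≤p = m≤m+n k d

    powers : ∀ {W} → Ladder G k d W → (2 + k) ^ length W ≤ Z
    powers {W} l = begin
      (2 + k) ^ length W            ≤⟨ ^-monoˡ-≤ (length W) (+-mono-≤ (m≤m+n 2 2) k≤p) ⟩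
      g ^ length W                  ≤⟨ ^-monoʳ-≤ g (ladder-bound uqw G∈C k≤p d≤p l) ⟩
      g ^ ladderBound s N p         ≤⟨ m≤n*m (g ^ ladderBound s N p) g ⟩
      Q                             ≡⟨ *-identityʳ Q ⟨
      Q * 1                         ≤⟨ *-monoʳ-≤ Q (≤-trans 1≤n′ n′≤n′²) ⟩
      Z                             ∎
      where open ≤-Reasoning

    cells : (1 + d) * n * n + suc n ≤ Z
    cells = begin
      (1 + d) * n * n + suc n                    ≤⟨ +-mono-≤ (≤-reflexive (*-assoc (1 + d) n n)) 1+n≤2n′² ⟩
      (1 + d) * (n * n) + 2 * n′ ^ 2             ≤⟨ +-monoˡ-≤ (2 * n′ ^ 2) (*-monoʳ-≤ (1 + d) nn≤n′²) ⟩
      (1 + d) * n′ ^ 2 + 2 * n′ ^ 2              ≡⟨ *-distribʳ-+ (n′ ^ 2) (1 + d) 2 ⟨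
      (1 + d + 2) * n′ ^ 2                       ≤⟨ scale (≤-trans (≤-reflexive (+-comm (1 + d) 2)) (+-mono-≤ (m≤m+n 3 1) d≤p)) ≤-refl ⟩
      Z                                          ∎
      where open ≤-Reasoning

    open Semantics G k d using (bits; bits-boolean; bits-length; layers; program-correct)
    open Domination G k d using (answer-correct; module Safety)

    safe : TabulationRun.Bounded dominationTable k d n bits bits-boolean bits-length (n * n) (layers + (1 + n)) Z
    safe = Safety.bounded Z
      (small (+-mono-≤ (m≤m+n 2 2) d≤p))
      (scale (+-mono-≤ (m≤m+n 2 2) d≤p) (≤-trans n≤n′ n′≤n′²))
      (≤-trans 1+n≤2n′² (scale (m≤m+n 2 (2 + p)) ≤-refl))
      (small (+-mono-≤ (m≤m+n 2 2) k≤p))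
      powers
      (≤-trans (≤-reflexive (sym (*-identityˡ (n * n)))) (scale (m≤m+n 1 (3 + p)) nn≤n′²))
      cells

    time-bound : ∀ h → Z ^ h ≡ Q ^ h * n′ ^ (2 * h)
    time-bound h = trans (^-distribʳ-* h Q (n′ ^ 2)) (cong (Q ^ h *_) (^-*-assoc n′ 2 h))
      where
      ^-distribʳ-* : ∀ h a b → (a * b) ^ h ≡ a ^ h * b ^ h
      ^-distribʳ-* zero    a b = refl
      ^-distribʳ-* (suc h) a b = trans (cong (a * b *_) (^-distribʳ-* h a b)) (interchange a b (a ^ h) (b ^ h))
        where
        interchange : ∀ a b x y → a * b * (x * y) ≡ a * x * (b * y)
        interchange = solve-∀

  decides : let (h , _) = Tabulation.poly-program-time dominationTable in
    Exec (Tabulation.program dominationTable) (initial (k ∷ d ∷ n ∷ bits))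
      (Q ^ h * n′ ^ (2 * h)) (λ M → M 0 ≡ 1 ⇔ HasDominatingSet G k d)
  decides =
    let (h , bound) = Tabulation.poly-program-time dominationTable in
    exec-≤ (≤-trans (bound Z (small (m≤m+n 2 (2 + p)))) (≤-reflexive (time-bound h)))
      (exec-map (λ e → subst (λ a → a ≡ 1 ⇔ HasDominatingSet G k d) (sym e) answer-correct)
        (program-correct Z safe))

corollary4p5 : (C : GraphClass) → BoundedExpansion C →
    (s : ℕ → ℕ) (N : ℕ → ℕ → ℕ) → Computable₁ s → Computable₂ N →
    UniformlyQuasiWide C s N →
    FixedParameterTractable (DistanceDominatingSet C)
corollary4p5 C _ s N cs cN uqw =
  let (h , _) = Tabulation.poly-program-time dominationTable in
  -- The exponent `h` comes from the expressions of the table alone, so it is the same for all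
  -- inputs. The loop bound is quadratic in the order, whence `2 * h`.
  Tabulation.program dominationTable , (λ p → parameterFactor s N p ^ h) , 2 * h ,
  computable-∘₂ computable-flip-^ (computable-const h) (computable-parameterFactor cs cN) ,
  λ (G , k , d) G∈C → decides uqw G G∈C k d
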